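{- Unless the Orthogonal Vectors Conjecture fails, \textsc{Path Contraction} on chordal graphs does not admit an algorithm running in time $\mathcal{O}(n^{2-\epsilon}\cdot 2^{o(tw)})$ for any $\epsilon>0$, where $n$ is the number of vertices and $tw$ the treewidth of the input graph.
   Context: All graphs are finite, simple and undirected. A graph is chordal if every induced cycle in it is a triangle. Contracting an edge $uv$ replaces $u,v$ by a new vertex adjacent to $N(u)\cup N(v)\setminus\{u,v\}$ (no loops or parallel edges). \textsc{Path Contraction}: given a connected undirected graph $G$ and an integer $k$, decide whether one can contract at most $k$ edges in $G$ to obtain a path. \textsc{Orthogonal Vectors}: given two sets $X=\{x_1,\ldots,x_n\}$ and $Y=\{y_1,\ldots,y_n\}$ of $d$-dimensional Boolean vectors, decide whether there exist $x_i\in X$, $y_j\in Y$ with $\langle x_i, y_j\rangle=0$. The Orthogonal Vectors Conjecture states that for every $\epsilon>0$, \textsc{Orthogonal Vectors} with $d=\mathcal{O}(\log n)$ cannot be solved in time $\mathcal{O}(n^{2-\epsilon})$. -}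

module Defs where

open import Data.Bool.Base using (Bool; true; false; T; not; _∧_; _∨_; if_then_else_)
open import Data.Bool.Properties using (∨-comm; T?)
open import Data.Fin.Base using (Fin; toℕ; punchIn)
import Data.Fin.Properties as Fin
open import Data.Fin.Permutation using (Permutation′; _⟨$⟩ʳ_)
open import Data.Fin.Subset using (Subset; _∈_; ∣_∣)
open import Data.List.Base using (List; []; _∷_; _++_; length; map; concatMap; allFin; filter; foldr)
open import Data.List.Scans.Base using (scanl)
open import Data.Nat.Base
open import Data.Nat.DivMod using (_/_; _%_)
open import Data.Nat.Logarithm using (⌈log₂_⌉)
open import Data.Product.Base using (Σ; ∃-syntax; _×_)
open import Data.Sum.Base using (_⊎_)
open import Data.Vec.Base as Vec using (Vec; toList)
open import Function.Base using (_∘_)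
open import Function.Bundles using (_⇔_)
open import Function.Definitions using (Injective)
open import Relation.Binary.Construct.Closure.ReflexiveTransitive using (Star)
open import Relation.Binary.PropositionalEquality using (_≡_; _≢_; refl; sym; cong; cong₂)
open import Relation.Nullary.Decidable.Core using (yes; no; ⌊_⌋)
open import Relation.Nullary.Negation.Core using (¬_; contradiction)
open import Relation.Binary.Core using (Rel)
open import Level using (0ℓ)

------------------------------------------------------------------------
-- Graphs

record Graph (n : ℕ) : Set where
  field
    adj     : Fin n → Fin n → Bool
    adj-sym : ∀ u v → adj u v ≡ adj v u
    irrefl  : ∀ v → adj v v ≡ false

open Graph public

Adj : ∀ {n} → Graph n → Rel (Fin n) 0ℓ
Adj G u v = T (adj G u v)

Connected : ∀ {n} → Graph n → Set
Connected {n} G = 1 ≤ n × (∀ u v → Star (Adj G) u v)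

CycleAdj : ∀ ℓ .{{_ : NonZero ℓ}} → Rel (Fin ℓ) 0ℓ
CycleAdj ℓ i j = (suc (toℕ i) % ℓ ≡ toℕ j) ⊎ (suc (toℕ j) % ℓ ≡ toℕ i)

IsCycle : ∀ {n} → Graph n → ∀ ℓ .{{_ : NonZero ℓ}} → (Fin ℓ → Fin n) → Set
IsCycle G ℓ γ = 3 ≤ ℓ × Injective _≡_ _≡_ γ ×
                (∀ i j → CycleAdj ℓ i j → Adj G (γ i) (γ j))

IsInducedCycle : ∀ {n} → Graph n → ∀ ℓ .{{_ : NonZero ℓ}} → (Fin ℓ → Fin n) → Set
IsInducedCycle G ℓ γ = IsCycle G ℓ γ ×
                       (∀ i j → Adj G (γ i) (γ j) → CycleAdj ℓ i j)

Chordal : ∀ {n} → Graph n → Set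
Chordal {n} G = ∀ ℓ .{{_ : NonZero ℓ}} (γ : Fin ℓ → Fin n) →
                IsInducedCycle G ℓ γ → ℓ ≡ 3

IsTree : ∀ {n} → Graph n → Set
IsTree {n} G = Connected G ×
               (∀ ℓ .{{_ : NonZero ℓ}} (γ : Fin ℓ → Fin n) → ¬ IsCycle G ℓ γ)

PathAdj : ∀ {m} → Rel (Fin m) 0ℓ
PathAdj i j = (suc (toℕ i) ≡ toℕ j) ⊎ (suc (toℕ j) ≡ toℕ i)

-- The one-vertex graph is a path.
IsPath : ∀ {m} → Graph m → Set
IsPath {m} G = 1 ≤ m × Σ (Permutation′ m) λ π →
                ∀ i j → Adj G (π ⟨$⟩ʳ i) (π ⟨$⟩ʳ j) ⇔ PathAdj i j

------------------------------------------------------------------------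
-- Edge contraction

-- Contraction of the edge u v.  The vertices of the result are those of G
-- other than v, listed by punchIn v; u plays the role of the new vertex, so
-- that it becomes adjacent to N(u) ∪ N(v) ∖ {u , v}.
contract : ∀ {n} → Graph (suc n) → (u v : Fin (suc n)) → Graph n
contract {n} G u v = record
  { adj     = λ i j → not ⌊ i Fin.≟ j ⌋ ∧ adjᶜ (punchIn v i) (punchIn v j)
  ; adj-sym = λ i j → cong₂ (λ b c → not b ∧ c)
                        (isYes-sym i j) (adjᶜ-sym (punchIn v i) (punchIn v j))
  ; irrefl  = λ i → cong (λ b → not b ∧ adjᶜ (punchIn v i) (punchIn v i)) (isYes-refl i)
  }
  where
  adjᶜ : Fin (suc n) → Fin (suc n) → Bool
  adjᶜ a b = adj G a b ∨ (⌊ a Fin.≟ u ⌋ ∧ adj G v b) ∨ (⌊ b Fin.≟ u ⌋ ∧ adj G v a)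

  adjᶜ-sym : ∀ a b → adjᶜ a b ≡ adjᶜ b a
  adjᶜ-sym a b = cong₂ _∨_ (adj-sym G a b) (∨-comm (⌊ a Fin.≟ u ⌋ ∧ adj G v b) _)

  isYes-refl : (i : Fin n) → ⌊ i Fin.≟ i ⌋ ≡ true
  isYes-refl i with i Fin.≟ i
  ... | yes _  = refl
  ... | no i≢i = contradiction refl i≢i

  isYes-sym : (i j : Fin n) → ⌊ i Fin.≟ j ⌋ ≡ ⌊ j Fin.≟ i ⌋
  isYes-sym i j with i Fin.≟ j | j Fin.≟ i
  ... | yes _   | yes _   = refl
  ... | no _    | no _    = refl
  ... | yes i≡j | no j≢i  = contradiction (sym i≡j) j≢i
  ... | no i≢j  | yes j≡i = contradiction (sym j≡i) i≢j

data _⟶[_]_ : ∀ {n m} → Graph n → ℕ → Graph m → Set where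
  done : ∀ {n} {G : Graph n} → G ⟶[ 0 ] G
  step : ∀ {n m k} {G : Graph (suc n)} {H : Graph m} (u v : Fin (suc n)) →
         Adj G u v → contract G u v ⟶[ k ] H → G ⟶[ suc k ] H

ContractsToPath : ∀ {n} → Graph n → ℕ → Set
ContractsToPath G k =
  ∃[ j ] (j ≤ k × (∃[ m ] Σ (Graph m) λ H → (G ⟶[ j ] H) × IsPath H))

------------------------------------------------------------------------
-- Treewidth

record TreeDecomposition {n} (G : Graph n) : Set where
  field
    nodes     : ℕ
    tree      : Graph nodes
    isTree    : IsTree tree
    bag       : Fin nodes → Subset n
    covers-V  : ∀ v → ∃[ t ] v ∈ bag t
    covers-E  : ∀ {u v} → Adj G u v → ∃[ t ] (u ∈ bag t × v ∈ bag t)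
    connected : ∀ v {s t} → v ∈ bag s → v ∈ bag t →
                Star (λ a b → Adj tree a b × v ∈ bag a × v ∈ bag b) s t

  width : ℕ
  width = foldr _⊔_ 0 (map (∣_∣ ∘ bag) (allFin nodes)) ∸ 1

IsTreewidth : ∀ {n} → Graph n → ℕ → Set
IsTreewidth G w = (Σ (TreeDecomposition G) λ D → TreeDecomposition.width D ≡ w)
                × ((D : TreeDecomposition G) → w ≤ TreeDecomposition.width D)

------------------------------------------------------------------------
-- Random access machine

-- Structured programs for a RAM with registers and one memory, both
-- initially zero except that the input occupies memory cells 0, 1, 2, ….
-- Instructions have unit cost.  The word size enters as a bound M on every
-- value written to a register; a program that would exceed it gets stuck, and
-- therefore has no run.  Below M is polynomial in the size of the input,
-- i.e. words have logarithmically many bits.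

Reg : Set
Reg = ℕ

data Op : Set where
  add sub mul quot rem less and shl shr : Op

_÷_ : ℕ → ℕ → ℕ
a ÷ zero  = 0
a ÷ suc b = a / suc b

_mod_ : ℕ → ℕ → ℕ
a mod zero  = 0
a mod suc b = a % suc b

bitAnd : ℕ → ℕ → ℕ
bitAnd a b = go a a b
  where
  -- The first argument only bounds the number of binary digits processed.
  go : ℕ → ℕ → ℕ → ℕ
  go zero    _ _ = 0
  go (suc f) x y = (x % 2) * (y % 2) + 2 * go f (x / 2) (y / 2)

bit : Bool → ℕ
bit b = if b then 1 else 0

⟦_⟧ : Op → ℕ → ℕ → ℕ
⟦ add  ⟧ a b = a + b
⟦ sub  ⟧ a b = a ∸ b
⟦ mul  ⟧ a b = a * b
⟦ quot ⟧ a b = a ÷ b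
⟦ rem  ⟧ a b = a mod b
⟦ less ⟧ a b = bit (a <ᵇ b)
⟦ and  ⟧ a b = bitAnd a b
⟦ shl  ⟧ a b = a * 2 ^ b
⟦ shr  ⟧ a b = a ÷ (2 ^ b)

data Program : Set where
  skip  : Program
  const : Reg → ℕ → Program
  arith : Reg → Op → Reg → Reg → Program
  load  : Reg → Reg → Program              -- load x a:  x ← mem[a]
  store : Reg → Reg → Program              -- store a x: mem[a] ← x
  _⨾_   : Program → Program → Program
  ifnz  : Reg → Program → Program → Program
  while : Reg → Program → Program          -- repeat as long as x ≠ 0

infixr 5 _⨾_

record State : Set where
  constructor ⟨_,_⟩
  field
    reg : Reg → ℕ
    mem : ℕ → ℕ

open State public

_[_↦_] : (ℕ → ℕ) → ℕ → ℕ → (ℕ → ℕ)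
(f [ i ↦ a ]) j = if i ≡ᵇ j then a else f j

setReg : State → Reg → ℕ → State
setReg σ x a = ⟨ reg σ [ x ↦ a ] , mem σ ⟩

setMem : State → ℕ → ℕ → State
setMem σ i a = ⟨ reg σ , mem σ [ i ↦ a ] ⟩

-- M ⊢ P , σ ⇓[ t ] τ: with values bounded by M, program P started in σ halts
-- in τ after t steps.
data _⊢_,_⇓[_]_ (M : ℕ) : Program → State → ℕ → State → Set where
  skip   : ∀ {σ} → M ⊢ skip , σ ⇓[ 1 ] σ
  const  : ∀ {σ x a} → a ≤ M → M ⊢ const x a , σ ⇓[ 1 ] setReg σ x a
  arith  : ∀ {σ x o y z} → let a = ⟦ o ⟧ (reg σ y) (reg σ z) in
           a ≤ M → M ⊢ arith x o y z , σ ⇓[ 1 ] setReg σ x a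
  load   : ∀ {σ x y} → let a = mem σ (reg σ y) in
           a ≤ M → M ⊢ load x y , σ ⇓[ 1 ] setReg σ x a
  store  : ∀ {σ y x} → M ⊢ store y x , σ ⇓[ 1 ] setMem σ (reg σ y) (reg σ x)
  seq    : ∀ {P Q ρ σ τ s t} → M ⊢ P , ρ ⇓[ s ] σ → M ⊢ Q , σ ⇓[ t ] τ →
           M ⊢ P ⨾ Q , ρ ⇓[ s + t ] τ
  ifnz-≢ : ∀ {P Q σ τ x t} → reg σ x ≢ 0 → M ⊢ P , σ ⇓[ t ] τ →
           M ⊢ ifnz x P Q , σ ⇓[ suc t ] τ
  ifnz-≡ : ∀ {P Q σ τ x t} → reg σ x ≡ 0 → M ⊢ Q , σ ⇓[ t ] τ →
           M ⊢ ifnz x P Q , σ ⇓[ suc t ] τ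
  loop   : ∀ {P ρ σ τ x s t} → reg ρ x ≢ 0 → M ⊢ P , ρ ⇓[ s ] σ →
           M ⊢ while x P , σ ⇓[ t ] τ → M ⊢ while x P , ρ ⇓[ suc (s + t) ] τ
  exit   : ∀ {P σ x} → reg σ x ≡ 0 → M ⊢ while x P , σ ⇓[ 1 ] σ

cell : List ℕ → ℕ → ℕ
cell []       _       = 0
cell (a ∷ as) zero    = a
cell (a ∷ as) (suc i) = cell as i

initial : List ℕ → State
initial as = ⟨ (λ _ → 0) , cell as ⟩

size : List ℕ → ℕ
size as = length as ⊔ foldr _⊔_ 0 as

Accepting : State → Set
Accepting σ = reg σ 0 ≡ 1

record Problem : Set₁ where
  field
    Instance : Set
    encode   : Instance → List ℕ
    Yes      : Instance → Set

open Problem public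

-- Some program decides Π with a running time t satisfying Bound I t on every
-- instance I, using words of O(log (size of the input)) bits.
DecidableWithin : (Π : Problem) → (Instance Π → ℕ → Set) → Set
DecidableWithin Π Bound =
  ∃[ P ] ∃[ w ] ((I : Instance Π) → let as = encode Π I in
    ∃[ t ] ∃[ τ ] ((((w + size as) ^ w) ⊢ P , initial as ⇓[ t ] τ)
                   × (Accepting τ ⇔ Yes Π I) × Bound I t))

------------------------------------------------------------------------
-- Orthogonal vectors

⟨_∙_⟩ : ∀ {d} → Vec Bool d → Vec Bool d → ℕ
⟨ x ∙ y ⟩ = Vec.sum (Vec.zipWith (λ a b → bit a * bit b) x y)

record OVInstance (c : ℕ) : Set where
  field
    n d : ℕ
    d≤  : d ≤ c * ⌈log₂ n ⌉
    X Y : Vec (Vec Bool d) n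

-- Orthogonal Vectors restricted to dimension at most c · log n.
OrthogonalVectors : ℕ → Problem
OrthogonalVectors c = record
  { Instance = OVInstance c
  ; encode   = λ I → let open OVInstance I in
                 n ∷ d ∷ map bit (concatMap toList (toList X) ++ concatMap toList (toList Y))
  ; Yes      = λ I → let open OVInstance I in
                 ∃[ i ] ∃[ j ] (⟨ Vec.lookup X i ∙ Vec.lookup Y j ⟩ ≡ 0)
  }

-- Here ε = p / q, and t ^ q * n ^ p ≤ (C * n ^ 2) ^ q says t ≤ C · n ^ (2 - ε).
-- Since n ^ (2 - ε) decreases as ε grows, rational ε suffice.
OVDecidable : (c p q : ℕ) → Set
OVDecidable c p q = ∃[ C ] DecidableWithin (OrthogonalVectors c)
  (λ I t → let open OVInstance I in t ^ q * n ^ p ≤ (C * n ^ 2) ^ q)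

-- Dimension O(log n) means dimension at most c · log n for an arbitrary
-- constant c, on which the algorithm may depend.
OrthogonalVectorsConjecture : Set
OrthogonalVectorsConjecture =
  ∀ (p q : ℕ) .{{_ : NonZero p}} .{{_ : NonZero q}} → ¬ (∀ c → OVDecidable c p q)

------------------------------------------------------------------------
-- Path contraction on chordal graphs

record ChordalInstance : Set where
  field
    n         : ℕ
    G         : Graph n
    connected : Connected G
    chordal   : Chordal G
    k         : ℕ

neighbours : ∀ {n} → Graph n → Fin n → List (Fin n)
neighbours G v = filter (λ u → T? (adj G v u)) (allFin _)

-- Adjacency lists in one array, preceded by the n + 1 offsets at which the
-- list of each vertex starts and the last one ends.
encodeGraph : ∀ {n} → Graph n → List ℕ
encodeGraph {n} G =
  scanl _+_ 0 (map (length ∘ neighbours G) (allFin n)) ++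
  concatMap (map toℕ ∘ neighbours G) (allFin n)

PathContractionOnChordal : Problem
PathContractionOnChordal = record
  { Instance = ChordalInstance
  ; encode   = λ I → let open ChordalInstance I in n ∷ k ∷ encodeGraph G
  ; Yes      = λ I → let open ChordalInstance I in ContractsToPath G k
  }

-- f t ∈ o(t).  An o(t) exponent with real values may be rounded up.
Sublinear : (ℕ → ℕ) → Set
Sublinear f = ∀ m → ∃[ t₀ ] (∀ t → t₀ ≤ t → m * f t ≤ t)

-- Running time O(n ^ (2 - ε) · 2 ^ o(tw)) with ε = p / q.
PathContractionDecidable : (p q : ℕ) → Set
PathContractionDecidable p q =
  ∃[ f ] (Sublinear f × (∃[ C ] DecidableWithin PathContractionOnChordal
    (λ I t → let open ChordalInstance I in
       ∀ tw → IsTreewidth G tw → t ^ q * n ^ p ≤ (C * n ^ 2 * 2 ^ f tw) ^ q)))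

-- Take a clique with one vertex per coordinate and two further vertices c₀ and c₁, and add
-- one independent vertex per vector, joined to the coordinates where the vector is 1 and to
-- c₀ (for X) or c₁ (for Y).  This split graph is chordal, and the clique together with one
-- more vertex at a time makes up the bags of a star-shaped decomposition of width O(log n).
-- If it contracts to a path on four or more vertices, then the ends of the path stem from
-- two independent vertices without common neighbour: one of X and one of Y, and orthogonal.
-- Conversely, for an orthogonal pair x, y the parts {x}, the vertices gathered around c₀,
-- those gathered around c₁, and {y} form a path.  A RAM writes down the graph in time
-- O(n log n), and 2 ^ o(tw) is below any power of n, so an algorithm for Path Contraction
-- with saving ε = p / q yields one for Orthogonal Vectors with saving 1 / (2 q).

module Submission where

-- The budget `N ∸ 4` is tight: with one more contraction every instance with n ≥ 1 becomes a path
-- on three vertices, two independent vertices being the ends and everything else the middle.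
--
-- The exponent 1 / (2 q) arises as follows. Since p ≥ 1, the assumed algorithm saves at least the
-- exponent 1 / q, and half of that pays for 2 ^ o(tw). Writing the graph must fit into the same
-- bound. It takes O(n D) steps, and D ^ 2 = O(n) makes this O(n ^ (3 / 2)); hence no loop may visit
-- all pairs of vertices.
--
-- The simulated algorithm is only known to work from the initial state of its own instance. All
-- registers and all cells beyond the graph must therefore be zero when it starts, and its run has
-- to be carried over to another word size and to a state that agrees only pointwise.
--
-- Its time bound speaks of the exact treewidth, a minimum that is never computed. The existence of
-- this minimum is available doubly negated, which suffices because the conclusion is a decidable
-- inequality between numbers.

open import Defs
open import Data.Bool.Base using (Bool; true; false; T; not; _∧_; _∨_; if_then_else_)
open import Data.Bool.Properties using (T-∧; T-∨; T-≡; T?)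
open import Data.Empty using (⊥; ⊥-elim)
open import Data.List.Base
  using (List; []; _∷_; _++_; _∷ʳ_; map; foldl; foldr; length; replicate; concat; concatMap;
         filter; allFin; applyUpTo; upTo; tabulate)
open import Data.List.Properties
  using (length-++; length-map; ++-assoc; ++-identityʳ; map-++; map-tabulate; concat-++;
         filter-++; foldl-∷ʳ; applyUpTo-∷ʳ)
open import Data.List.Relation.Unary.All as All using (All; []; _∷_)
open import Data.List.Relation.Unary.All.Properties using (∷ʳ⁺)
open import Data.List.Scans.Base using (scanl)
open import Data.Nat.Base
open import Data.Nat.DivMod using (m<n⇒m%n≡m)
open import Data.Nat.Induction using (<-rec)
open import Data.Nat.ListAction using (sum)
open import Data.Nat.ListAction.Properties using (sum-++)
open import Data.Nat.Logarithm using (⌈log₂_⌉; ⌈log₂⌈n/2⌉⌉≡⌈log₂n⌉∸1)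
open import Data.Nat.Properties
open import Data.Nat.Tactic.RingSolver using (solve-∀)
open import Data.Product.Base using (Σ; ∃-syntax; _×_; _,_; proj₁; proj₂)
open import Data.Sum.Base as Sum using (_⊎_; inj₁; inj₂; [_,_]′)
open import Function.Base using (_∘_; id)
open import Function.Bundles using (_⇔_; mk⇔; Equivalence)
open import Relation.Binary.Construct.Closure.ReflexiveTransitive as Star using (Star; ε; _◅_; _◅◅_)
open import Relation.Binary.Definitions using (tri<; tri≈; tri>)
open import Relation.Binary.PropositionalEquality
open import Relation.Nullary.Decidable.Core
  using (Dec; yes; no; ⌊_⌋; toWitness; fromWitness; decidable-stable)
open import Relation.Nullary.Negation.Core using (¬_; contradiction)

open Equivalence

-- Arithmetic

module _ where

  open ≤-Reasoning

  ^-distribʳ-* : ∀ k m n → (m * n) ^ k ≡ m ^ k * n ^ k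
  ^-distribʳ-* zero    m n = refl
  ^-distribʳ-* (suc k) m n = trans (cong (m * n *_) (^-distribʳ-* k m n)) (interchange m n (m ^ k) (n ^ k))
    where
    interchange : ∀ a b c d → a * b * (c * d) ≡ a * c * (b * d)
    interchange = solve-∀

  m≤m^n : ∀ m n .{{_ : NonZero n}} → m ≤ m ^ n
  m≤m^n zero      (suc n) = z≤n
  m≤m^n m@(suc _) (suc n) = m≤m*n m (m ^ n) {{m^n≢0 m n}}

  n<2^n : ∀ n → n < 2 ^ n
  n<2^n zero    = s≤s z≤n
  n<2^n (suc n) = begin
    2 + n            ≤⟨ +-mono-≤ (m^n>0 2 n) (n<2^n n) ⟩
    2 ^ n + 2 ^ n    ≡⟨ cong (2 ^ n +_) (+-identityʳ (2 ^ n)) ⟨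
    2 ^ suc n        ∎

  -- Consecutive squares differ by at most 4 (1 + n), and `n<2^n` bounds this by the growth of the
  -- right side. With a logarithm for n it makes the square of a logarithm linear.
  [1+n]²≤4*2^n : ∀ n → suc n * suc n ≤ 4 * 2 ^ n
  [1+n]²≤4*2^n zero    = m≤m+n 1 3
  [1+n]²≤4*2^n (suc n) = begin
    suc (suc n) * suc (suc n)          ≤⟨ m≤m+n _ (suc n + n) ⟩
    suc (suc n) * suc (suc n) + (suc n + n)  ≡⟨ expand n ⟩
    suc n * suc n + 4 * suc n          ≤⟨ +-mono-≤ ([1+n]²≤4*2^n n) (*-monoʳ-≤ 4 (n<2^n n)) ⟩
    4 * 2 ^ n + 4 * 2 ^ n              ≡⟨ double (2 ^ n) ⟩
    4 * 2 ^ suc n                      ∎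
    where
    expand : ∀ n → suc (suc n) * suc (suc n) + (suc n + n) ≡ suc n * suc n + 4 * suc n
    expand = solve-∀
    double : ∀ a → 4 * a + 4 * a ≡ 4 * (2 * a)
    double = solve-∀

  -- The slack of 2 is what the rounding of ⌈ n /2⌉ costs in the induction.
  2^⌈log₂n⌉+2≤2n : ∀ n → 2 ≤ n → 2 ^ ⌈log₂ n ⌉ + 2 ≤ n + n
  2^⌈log₂n⌉+2≤2n = <-rec (λ n → 2 ≤ n → 2 ^ ⌈log₂ n ⌉ + 2 ≤ n + n) go
    where
    go : ∀ n → (∀ {m} → m < n → 2 ≤ m → 2 ^ ⌈log₂ m ⌉ + 2 ≤ m + m) →
         2 ≤ n → 2 ^ ⌈log₂ n ⌉ + 2 ≤ n + n
    go 1 _ (s≤s ())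
    go 2 _ _ = ≤-refl
    go n@(suc (suc (suc k))) rec _ = +-cancelʳ-≤ 2 _ _ (begin
      2 ^ ⌈log₂ n ⌉ + 2 + 2            ≤⟨ +-monoˡ-≤ 2 (+-monoˡ-≤ 2 (^-monoʳ-≤ 2 (m≤n+m∸n ⌈log₂ n ⌉ 1))) ⟩
      2 ^ suc (⌈log₂ n ⌉ ∸ 1) + 2 + 2  ≡⟨ cong (λ l → 2 ^ suc l + 2 + 2) (⌈log₂⌈n/2⌉⌉≡⌈log₂n⌉∸1 n) ⟨
      2 ^ suc ⌈log₂ m ⌉ + 2 + 2        ≡⟨ double (2 ^ ⌈log₂ m ⌉) ⟩
      2 * (2 ^ ⌈log₂ m ⌉ + 2)          ≤⟨ *-monoʳ-≤ 2 (rec (⌈n/2⌉<n (suc k)) (s≤s (s≤s z≤n))) ⟩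
      2 * (m + m)                      ≤⟨ *-monoʳ-≤ 2 (+-monoˡ-≤ m (⌊n/2⌋-mono {suc n} {2 + n} (n≤1+n _))) ⟩
      2 * (⌊ 2 + n /2⌋ + m)            ≡⟨ cong (2 *_) (cong suc (⌊n/2⌋+⌈n/2⌉≡n n)) ⟩
      2 * (1 + n)                      ≡⟨ simplify n ⟩
      n + n + 2                        ∎)
      where
      m = ⌈ n /2⌉
      double : ∀ a → 2 * a + 2 + 2 ≡ 2 * (a + 2)
      double = solve-∀
      simplify : ∀ a → 2 * (1 + a) ≡ a + a + 2
      simplify = solve-∀

  2^⌈log₂n⌉≤2n : ∀ n → 1 ≤ n → 2 ^ ⌈log₂ n ⌉ ≤ n + n
  2^⌈log₂n⌉≤2n 1             _ = m≤m+n 1 1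
  2^⌈log₂n⌉≤2n n@(suc (suc _)) _ = ≤-trans (m≤m+n _ 2) (2^⌈log₂n⌉+2≤2n n (s≤s (s≤s z≤n)))

  ⌈log₂n⌉≤2n : ∀ n → 1 ≤ n → ⌈log₂ n ⌉ ≤ n + n
  ⌈log₂n⌉≤2n n 1≤n = ≤-trans (<⇒≤ (n<2^n ⌈log₂ n ⌉)) (2^⌈log₂n⌉≤2n n 1≤n)

  -- The sum serves as a crude maximum of finitely many values.
  ≤-sum : ∀ (f : ℕ → ℕ) {i n} → i < n → f i ≤ sum (applyUpTo f n)
  ≤-sum f {zero}  {suc n} _         = m≤m+n (f 0) _
  ≤-sum f {suc i} {suc n} (s≤s i<n) = ≤-trans (≤-sum (f ∘ suc) i<n) (m≤n+m _ (f 0))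

  -- A sublinear exponent of a logarithmic treewidth contributes n to an arbitrarily small power.
  sublinear-bound : ∀ {f} → Sublinear f → ∀ c k → ∃[ R ] (1 ≤ R × ∀ n tw → 1 ≤ n →
                    tw ≤ 2 + c * ⌈log₂ n ⌉ → 2 ^ (k * f tw) ≤ R * n)
  sublinear-bound {f} sublinear c k = 8 + S , s≤s z≤n , bound
    where
    t₀ S : ℕ
    -- The slope is chosen so that tw ≤ (c + 1) (2 + log n) leaves exactly 2 + log n for k * f tw.
    -- Taking c + 1 instead of c keeps the cancelled factor positive.
    t₀ = proj₁ (sublinear (suc c * k))
    S = 2 ^ (k * sum (applyUpTo f t₀))
    bound : ∀ n tw → 1 ≤ n → tw ≤ 2 + c * ⌈log₂ n ⌉ → 2 ^ (k * f tw) ≤ (8 + S) * n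
    bound n tw 1≤n tw≤ with <-≤-connex tw t₀
    -- Sublinearity is silent below `t₀`; the finitely many values of f there go into the constant
    -- S.
    ... | inj₁ tw<t₀ = begin
      2 ^ (k * f tw)   ≤⟨ ^-monoʳ-≤ 2 (*-monoʳ-≤ k (≤-sum f tw<t₀)) ⟩
      S                ≤⟨ m≤n+m S 8 ⟩
      8 + S            ≤⟨ m≤m*n (8 + S) n {{>-nonZero 1≤n}} ⟩
      (8 + S) * n      ∎
    ... | inj₂ t₀≤tw = begin
      2 ^ (k * f tw)        ≤⟨ ^-monoʳ-≤ 2 exponent ⟩
      2 ^ (2 + ⌈log₂ n ⌉)   ≡⟨ assoc (2 ^ ⌈log₂ n ⌉) ⟩
      4 * 2 ^ ⌈log₂ n ⌉     ≤⟨ *-monoʳ-≤ 4 (2^⌈log₂n⌉≤2n n 1≤n) ⟩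
      4 * (n + n)           ≡⟨ eight n ⟩
      8 * n                 ≤⟨ *-monoˡ-≤ n (m≤m+n 8 S) ⟩
      (8 + S) * n           ∎
      where
      assoc : ∀ a → 2 * (2 * a) ≡ 4 * a
      assoc = solve-∀
      eight : ∀ a → 4 * (a + a) ≡ 8 * a
      eight = solve-∀
      regroup : ∀ c l → 2 + c * l + (c * 2 + l) ≡ suc c * (2 + l)
      regroup = solve-∀
      exponent : k * f tw ≤ 2 + ⌈log₂ n ⌉
      exponent = *-cancelˡ-≤ (suc c) (begin
        suc c * (k * f tw)     ≡⟨ *-assoc (suc c) k (f tw) ⟨
        suc c * k * f tw       ≤⟨ proj₂ (sublinear (suc c * k)) tw t₀≤tw ⟩
        tw                     ≤⟨ tw≤ ⟩
        2 + c * ⌈log₂ n ⌉      ≤⟨ m≤m+n _ _ ⟩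
        2 + c * ⌈log₂ n ⌉ + (c * 2 + ⌈log₂ n ⌉) ≡⟨ regroup c ⌈log₂ n ⌉ ⟩
        suc c * (2 + ⌈log₂ n ⌉) ∎)

  twice-larger : ∀ {u v b m} k → u ≤ v → v ^ k * m ≤ b ^ k → (u + v) ^ k * m ≤ (2 * b) ^ k
  twice-larger {u} {v} {b} {m} k u≤v h = begin
    (u + v) ^ k * m          ≤⟨ *-monoˡ-≤ m (^-monoˡ-≤ k (≤-trans (+-monoˡ-≤ v u≤v)
                                  (≤-reflexive (cong (v +_) (sym (+-identityʳ v)))))) ⟩
    (2 * v) ^ k * m          ≡⟨ cong (_* m) (^-distribʳ-* k 2 v) ⟩
    2 ^ k * v ^ k * m        ≡⟨ *-assoc (2 ^ k) (v ^ k) m ⟩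
    2 ^ k * (v ^ k * m)      ≤⟨ *-monoʳ-≤ (2 ^ k) h ⟩
    2 ^ k * b ^ k            ≡⟨ ^-distribʳ-* k 2 b ⟨
    (2 * b) ^ k              ∎

  -- An inequality t ^ k * m ≤ b ^ k states t ≤ b / m ^ (1 / k) without roots. Such bounds are added
  -- by replacing the sum with twice its larger summand.
  sum-time : ∀ {a x b m} k → a ^ k * m ≤ b ^ k → x ^ k * m ≤ b ^ k → (a + x) ^ k * m ≤ (2 * b) ^ k
  sum-time {a} {x} {b} {m} k ha hx with ≤-total a x
  ... | inj₁ a≤x = twice-larger k a≤x hx
  ... | inj₂ x≤a = subst (λ s → s ^ k * m ≤ (2 * b) ^ k) (+-comm x a) (twice-larger k x≤a ha)

  -- A time of O(n D) with D² = O(n) is O(n^(2 - 1/2)).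
  transform-time : ∀ {a n e} q .{{_ : NonZero q}} → 1 ≤ n → a ^ 2 ≤ e * n ^ 3 →
                   a ^ (2 * q) * n ≤ (e * n ^ 2) ^ (2 * q)
  transform-time {a} {n} {e} q 1≤n h = begin
    a ^ (2 * q) * n               ≡⟨ cong (_* n) (^-*-assoc a 2 q) ⟨
    (a ^ 2) ^ q * n               ≤⟨ *-mono-≤ (^-monoˡ-≤ q h) (m≤m^n n q) ⟩
    (e * n ^ 3) ^ q * n ^ q       ≡⟨ ^-distribʳ-* q (e * n ^ 3) n ⟨
    -- Enlarging e to e * e makes the base a perfect square, as the exponent 2 q requires.
    (e * n ^ 3 * n) ^ q           ≤⟨ ^-monoˡ-≤ q (≤-trans (≤-reflexive (fourth e n)) (*-monoˡ-≤ _ (e≤e² e))) ⟩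
    (e * e * (n ^ 2 * n ^ 2)) ^ q ≡⟨ cong (_^ q) (square e (n ^ 2)) ⟩
    ((e * n ^ 2) ^ 2) ^ q         ≡⟨ ^-*-assoc (e * n ^ 2) 2 q ⟩
    (e * n ^ 2) ^ (2 * q)         ∎
    where
    fourth : ∀ e n → e * (n * (n * (n * 1))) * n ≡ e * (n * (n * 1) * (n * (n * 1)))
    fourth = solve-∀
    square : ∀ e m → e * e * (m * m) ≡ e * m * (e * m * 1)
    square = solve-∀
    e≤e² : ∀ e → e ≤ e * e
    e≤e² zero    = z≤n
    e≤e² e@(suc _) = m≤m*n e e

  -- Here x is the simulated time and y the factor 2 ^ f tw. Of the saving only N ^ p ≥ n is kept.
  -- Squaring turns this n into n * n: one factor pays for y ^ (2 q) ≤ R n and is cancelled, the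
  -- other is the saving 1 / (2 q) that remains.
  simulation-time : ∀ {x y n N C g R} p q .{{_ : NonZero p}} .{{_ : NonZero q}} →
    1 ≤ n → n ≤ N → N ≤ g * n → 1 ≤ R → y ^ (2 * q) ≤ R * n → x ^ q * N ^ p ≤ (C * N ^ 2 * y) ^ q →
    x ^ (2 * q) * n ≤ (C * g ^ 2 * R * n ^ 2) ^ (2 * q)
  simulation-time {x} {y} {n} {N} {C} {g} {R} p q 1≤n n≤N N≤gn 1≤R hy h =
    *-cancelʳ-≤ _ _ n {{>-nonZero 1≤n}} (begin
      x ^ (2 * q) * n * n                   ≡⟨ cong (λ z → z * n * n) (trans (cong (x ^_) (*-comm 2 q))
                                                                                  (sym (^-*-assoc x q 2))) ⟩
      (x ^ q) ^ 2 * n * n                   ≡⟨ square (x ^ q) n ⟩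
      (x ^ q * n) ^ 2                       ≤⟨ ^-monoˡ-≤ 2 h′ ⟩
      ((B * y) ^ q) ^ 2                     ≡⟨ trans (^-*-assoc (B * y) q 2) (cong ((B * y) ^_) (*-comm q 2)) ⟩
      (B * y) ^ (2 * q)                     ≡⟨ ^-distribʳ-* (2 * q) B y ⟩
      B ^ (2 * q) * y ^ (2 * q)             ≤⟨ *-monoʳ-≤ (B ^ (2 * q)) hy ⟩
      B ^ (2 * q) * (R * n)                 ≡⟨ *-assoc (B ^ (2 * q)) R n ⟨
      B ^ (2 * q) * R * n                   ≤⟨ *-monoˡ-≤ n (*-monoʳ-≤ (B ^ (2 * q)) (m≤m^n R (2 * q) {{m*n≢0 2 q}})) ⟩
      B ^ (2 * q) * R ^ (2 * q) * n         ≡⟨ cong (_* n) (^-distribʳ-* (2 * q) B R) ⟨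
      (B * R) ^ (2 * q) * n                 ≡⟨ cong (λ z → z ^ (2 * q) * n) (rotate (C * g ^ 2) (n ^ 2) R) ⟩
      (C * g ^ 2 * R * n ^ 2) ^ (2 * q) * n ∎)
    where
    B : ℕ
    B = C * g ^ 2 * n ^ 2
    square : ∀ a n → a * (a * 1) * n * n ≡ a * n * (a * n * 1)
    square = solve-∀
    rotate : ∀ a b c → a * b * c ≡ a * c * b
    rotate = solve-∀
    distrib : ∀ C g n → C * (g * n * (g * n * 1)) ≡ C * (g * (g * 1)) * (n * (n * 1))
    distrib = solve-∀
    h′ : x ^ q * n ≤ (B * y) ^ q
    h′ = begin
      x ^ q * n                  ≤⟨ *-monoʳ-≤ (x ^ q) (≤-trans n≤N (m≤m^n N p)) ⟩
      x ^ q * N ^ p              ≤⟨ h ⟩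
      (C * N ^ 2 * y) ^ q        ≤⟨ ^-monoˡ-≤ q (*-monoˡ-≤ y (*-monoʳ-≤ C (^-monoˡ-≤ 2 N≤gn))) ⟩
      (C * (g * n) ^ 2 * y) ^ q  ≡⟨ cong (λ z → (z * y) ^ q) (distrib C g n) ⟩
      (B * y) ^ q                ∎

  -- The left side is the step count as the programs compose: 4 for the entry, 17 for sizes and
  -- header, two passes, and the move of the output. Z stands for D * N.
  transform-steps : ∀ {K L F Z} → K ≤ 3 * Z → L ≤ Z → F ≤ 7 * Z + 3 → 1 ≤ Z →
    4 + (17 + (5 + 23 * K + (5 + 23 * K + (13 + 7 * (L + F))))) ≤ 259 * Z
  transform-steps {K} {L} {F} {Z} hK hL hF hZ = begin
    4 + (17 + (5 + 23 * K + (5 + 23 * K + (13 + 7 * (L + F)))))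
      ≤⟨ +-monoʳ-≤ 4 (+-monoʳ-≤ 17 (+-mono-≤ pass (+-mono-≤ pass (+-monoʳ-≤ 13 (*-monoʳ-≤ 7 (+-mono-≤ hL hF)))))) ⟩
    4 + (17 + (5 + 23 * (3 * Z) + (5 + 23 * (3 * Z) + (13 + 7 * (Z + (7 * Z + 3))))))
      ≡⟨ regroup Z ⟩
    65 + 194 * Z
      ≤⟨ +-monoˡ-≤ (194 * Z) (*-monoʳ-≤ 65 hZ) ⟩
    65 * Z + 194 * Z
      ≡⟨ *-distribʳ-+ Z 65 194 ⟨
    259 * Z ∎
    where
    open ≤-Reasoning
    pass : 5 + 23 * K ≤ 5 + 23 * (3 * Z)
    pass = +-monoʳ-≤ 5 (*-monoʳ-≤ 23 hK)
    regroup : ∀ Z → 4 + (17 + (5 + 23 * (3 * Z) + (5 + 23 * (3 * Z) + (13 + 7 * (Z + (7 * Z + 3))))))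
                    ≡ 65 + 194 * Z
    regroup = solve-∀

  word-estimate : ∀ {w L F Z y} → L ≤ Z → F ≤ 7 * Z + 3 → Z ≤ 6 * y → 1 ≤ y →
                  w + (L + (L + F)) ≤ (w + 100) * y
  word-estimate {w} {L} {F} {Z} {y} hL hF hZ hy = begin
    w + (L + (L + F))                  ≤⟨ +-monoʳ-≤ w (+-mono-≤ hL (+-mono-≤ hL hF)) ⟩
    w + (Z + (Z + (7 * Z + 3)))        ≡⟨ regroup w Z ⟩
    w + (9 * Z + 3)                    ≤⟨ +-mono-≤ (m≤m*n w y {{>-nonZero hy}})
                                            (+-mono-≤ (*-monoʳ-≤ 9 hZ) (*-monoʳ-≤ 3 hy)) ⟩
    w * y + (9 * (6 * y) + 3 * y)      ≤⟨ m≤m+n _ (43 * y) ⟩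
    w * y + (9 * (6 * y) + 3 * y) + 43 * y ≡⟨ collect w y ⟩
    (w + 100) * y                      ∎
    where
    open ≤-Reasoning
    regroup : ∀ w Z → w + (Z + (Z + (7 * Z + 3))) ≡ w + (9 * Z + 3)
    regroup = solve-∀
    collect : ∀ w y → w * y + (9 * (6 * y) + 3 * y) + 43 * y ≡ (w + 100) * y
    collect = solve-∀

  ^-mono-≤ : ∀ {m n k l} .{{_ : NonZero n}} → m ≤ n → k ≤ l → m ^ k ≤ n ^ l
  ^-mono-≤ {n = n} {k} m≤n k≤l = ≤-trans (^-monoˡ-≤ k m≤n) (^-monoʳ-≤ n k≤l)

  -- The 8 is the 4 of `[1+n]²≤4*2^n` times the 2 lost when the logarithm is rounded up.
  columns-bound : ∀ {c d n} → 1 ≤ n → d ≤ c * ⌈log₂ n ⌉ → (2 + d) * (2 + d) ≤ (2 + c) * (2 + c) * 8 * n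
  columns-bound {c} {d} {n} 1≤n d≤ = begin
    (2 + d) * (2 + d)                          ≤⟨ *-mono-≤ D≤ D≤ ⟩
    (2 + c) * suc ℓ * ((2 + c) * suc ℓ)        ≡⟨ interchange (2 + c) (suc ℓ) ⟩
    (2 + c) * (2 + c) * (suc ℓ * suc ℓ)        ≤⟨ *-monoʳ-≤ ((2 + c) * (2 + c)) ([1+n]²≤4*2^n ℓ) ⟩
    (2 + c) * (2 + c) * (4 * 2 ^ ℓ)            ≤⟨ *-monoʳ-≤ ((2 + c) * (2 + c)) (*-monoʳ-≤ 4 (2^⌈log₂n⌉≤2n n 1≤n)) ⟩
    (2 + c) * (2 + c) * (4 * (n + n))          ≡⟨ collect ((2 + c) * (2 + c)) n ⟩
    (2 + c) * (2 + c) * 8 * n                  ∎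
    where
    open ≤-Reasoning
    ℓ = ⌈log₂ n ⌉
    expand : ∀ c l → 2 + c * l + (c + 2 * l) ≡ (2 + c) * suc l
    expand = solve-∀
    interchange : ∀ a b → a * b * (a * b) ≡ a * a * (b * b)
    interchange = solve-∀
    collect : ∀ a n → a * (4 * (n + n)) ≡ a * 8 * n
    collect = solve-∀
    D≤ : 2 + d ≤ (2 + c) * suc ℓ
    D≤ = ≤-trans (+-monoʳ-≤ 2 d≤) (≤-trans (m≤m+n _ (c + 2 * ℓ)) (≤-reflexive (expand c ℓ)))

  -- A logarithm may be replaced by 2 n here, because the number of vertices only has to be linear
  -- in n.
  vertices-bound : ∀ {c d n} → 1 ≤ n → d ≤ c * ⌈log₂ n ⌉ → n + n + (2 + d) ≤ (4 + 2 * c) * n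
  vertices-bound {c} {d} {n} 1≤n d≤ = begin
    n + n + (2 + d)                ≤⟨ +-monoʳ-≤ (n + n) (+-mono-≤ (+-mono-≤ 1≤n 1≤n)
                                        (≤-trans d≤ (*-monoʳ-≤ c (⌈log₂n⌉≤2n n 1≤n)))) ⟩
    n + n + (n + n + c * (n + n))  ≡⟨ collect c n ⟩
    (4 + 2 * c) * n                ∎
    where
    open ≤-Reasoning
    collect : ∀ c n → n + n + (n + n + c * (n + n)) ≡ (4 + 2 * c) * n
    collect = solve-∀

  square-bound : ∀ k {D N n h g a} → D * D ≤ h * n → N ≤ g * n → a ≤ k * (D * N) →
                 a ^ 2 ≤ k * k * h * (g * g) * n ^ 3
  square-bound k {D} {N} {n} {h} {g} {a} hD hN ha = begin
    a ^ 2                              ≤⟨ ^-monoˡ-≤ 2 ha ⟩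
    (k * (D * N)) ^ 2                  ≡⟨ split k D N ⟩
    k * k * (D * D) * (N * N)          ≤⟨ *-mono-≤ (*-monoʳ-≤ (k * k) hD) (*-mono-≤ hN hN) ⟩
    k * k * (h * n) * (g * n * (g * n)) ≡⟨ collect k h g n ⟩
    k * k * h * (g * g) * n ^ 3        ∎
    where
    open ≤-Reasoning
    split : ∀ k D N → k * (D * N) * (k * (D * N) * 1) ≡ k * k * (D * D) * (N * N)
    split = solve-∀
    collect : ∀ k h g n → k * k * (h * n) * (g * n * (g * n)) ≡ k * k * h * (g * g) * (n * (n * (n * 1)))
    collect = solve-∀

sum-applyUpTo-suc : ∀ (f : ℕ → ℕ) n → sum (applyUpTo f (suc n)) ≡ sum (applyUpTo f n) + f n
sum-applyUpTo-suc f n = begin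
  sum (applyUpTo f (suc n))      ≡⟨ cong sum (applyUpTo-∷ʳ f n) ⟨
  sum (applyUpTo f n ∷ʳ f n)     ≡⟨ sum-++ (applyUpTo f n) _ ⟩
  sum (applyUpTo f n) + (f n + 0) ≡⟨ cong (sum (applyUpTo f n) +_) (+-identityʳ (f n)) ⟩
  sum (applyUpTo f n) + f n ∎
  where open ≡-Reasoning

sum-applyUpTo-≤ : ∀ {f g : ℕ → ℕ} k n → (∀ i → f i ≤ k * g i) →
                  sum (applyUpTo f n) ≤ k * sum (applyUpTo g n)
sum-applyUpTo-≤ k zero h = z≤n
sum-applyUpTo-≤ {f} {g} k (suc n) h = begin
  f 0 + sum (applyUpTo (f ∘ suc) n)            ≤⟨ +-mono-≤ (h 0) (sum-applyUpTo-≤ k n (h ∘ suc)) ⟩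
  k * g 0 + k * sum (applyUpTo (g ∘ suc) n)    ≡⟨ *-distribˡ-+ k (g 0) _ ⟨
  k * (g 0 + sum (applyUpTo (g ∘ suc) n))      ∎
  where open ≤-Reasoning

sum-applyUpTo-const : ∀ c n → sum (applyUpTo (λ _ → c) n) ≡ n * c
sum-applyUpTo-const c zero    = refl
sum-applyUpTo-const c (suc n) = cong (c +_) (sum-applyUpTo-const c n)

sum-applyUpTo-≤-+ : ∀ {f g : ℕ → ℕ} k m → (∀ i → f i ≤ k + g i) →
                    sum (applyUpTo f m) ≤ m * k + sum (applyUpTo g m)
sum-applyUpTo-≤-+ k zero h = z≤n
sum-applyUpTo-≤-+ {f} {g} k (suc m) h = begin
  f 0 + sum (applyUpTo (f ∘ suc) m)                      ≤⟨ +-mono-≤ (h 0) (sum-applyUpTo-≤-+ k m (h ∘ suc)) ⟩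
  k + g 0 + (m * k + sum (applyUpTo (g ∘ suc) m))        ≡⟨ regroup k (g 0) (m * k) _ ⟩
  k + m * k + (g 0 + sum (applyUpTo (g ∘ suc) m))        ∎
  where
  open ≤-Reasoning
  regroup : ∀ a b c d → a + b + (c + d) ≡ a + c + (b + d)
  regroup = solve-∀

sum-initial-≤ : ∀ D N m → sum (applyUpTo (λ v → if v <ᵇ D then N else 0) m) ≤ D * N
sum-initial-≤ D       N zero    = z≤n
sum-initial-≤ zero    N (suc m) = sum-initial-≤ zero N m
sum-initial-≤ (suc D) N (suc m) = +-monoʳ-≤ N (sum-initial-≤ D N m)

-- For undecidable P a minimum cannot be searched for. If there were none, strong induction would
-- refute P at every number.
¬¬-least : ∀ {P : ℕ → Set} {k} → P k → ¬ ¬ (∃[ m ] (P m × ∀ j → P j → m ≤ j))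
¬¬-least {P} {k} Pk none = <-rec (λ k → ¬ P k)
  (λ k smaller Pk → none (k , Pk , λ j Pj → ≮⇒≥ (λ j<k → smaller j<k Pj))) k Pk

<ᵇ-true : ∀ {i j} → i < j → (i <ᵇ j) ≡ true
<ᵇ-true i<j = Equivalence.to T-≡ (<⇒<ᵇ i<j)

<ᵇ-false : ∀ {i j} → j ≤ i → (i <ᵇ j) ≡ false
<ᵇ-false {i} {j} j≤i with i <ᵇ j in eq
... | true  = contradiction (<ᵇ⇒< i j (subst T (sym eq) _)) (≤⇒≯ j≤i)
... | false = refl

≡ᵇ-refl : ∀ i → (i ≡ᵇ i) ≡ true
≡ᵇ-refl i = Equivalence.to T-≡ (≡⇒≡ᵇ i i refl)

≡ᵇ-false : ∀ {i j} → i ≢ j → (i ≡ᵇ j) ≡ false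
≡ᵇ-false {i} {j} i≢j with i ≡ᵇ j in eq
... | true  = contradiction (≡ᵇ⇒≡ i j (subst T (sym eq) _)) i≢j
... | false = refl

bit≤1 : ∀ b → bit b ≤ 1
bit≤1 true  = ≤-refl
bit≤1 false = z≤n

-- Programs up to pointwise equality of states

-- Writing past the end pads with 0, the value that `cell` reads there, so that `cell-upd` holds at
-- every index.
upd : List ℕ → ℕ → ℕ → List ℕ
upd []       zero    a = a ∷ []
upd []       (suc i) a = 0 ∷ upd [] i a
upd (_ ∷ vs) zero    a = a ∷ vs
upd (v ∷ vs) (suc i) a = v ∷ upd vs i a

cell-upd : ∀ vs x a → cell vs [ x ↦ a ] ≗ cell (upd vs x a)
cell-upd []       zero    a zero    = refl
cell-upd []       zero    a (suc j) = refl
cell-upd []       (suc x) a zero    = refl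
cell-upd []       (suc x) a (suc j) = cell-upd [] x a j
cell-upd (v ∷ vs) zero    a zero    = refl
cell-upd (v ∷ vs) zero    a (suc j) = refl
cell-upd (v ∷ vs) (suc x) a zero    = refl
cell-upd (v ∷ vs) (suc x) a (suc j) = cell-upd vs x a j

↦-cong : ∀ {f g : ℕ → ℕ} i {j a b} → f ≗ g → i ≡ j → a ≡ b → f [ i ↦ a ] ≗ g [ j ↦ b ]
↦-cong i f≗g refl refl k with i ≡ᵇ k
... | true  = refl
... | false = f≗g k

record _≈_ (σ τ : State) : Set where
  constructor _,_
  field
    reg≗ : reg σ ≗ reg τ
    mem≗ : mem σ ≗ mem τ
open _≈_

-- Needed to restart the assumed algorithm in the state that the transformation leaves behind, which
-- agrees with `initial` of the encoded graph only pointwise.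
run-resp : ∀ {M P σ σ′ τ t} → σ ≈ σ′ → M ⊢ P , σ ⇓[ t ] τ →
           ∃[ τ′ ] (M ⊢ P , σ′ ⇓[ t ] τ′ × τ ≈ τ′)
run-resp e skip = _ , skip , e
run-resp (r , m) (const {x = x} a≤M) = _ , const a≤M , (↦-cong x r refl refl , m)
run-resp {M} (r , m) (arith {x = x} {o} {y} {z} a≤M) =
  let eq = cong₂ ⟦ o ⟧ (r y) (r z) in
  _ , arith (subst (_≤ M) eq a≤M) , (↦-cong x r refl eq , m)
run-resp {M} {σ′ = σ′} (r , m) (load {x = x} {y} a≤M) =
  let eq = trans (m _) (cong (mem σ′) (r y)) in
  _ , load (subst (_≤ M) eq a≤M) , (↦-cong x r refl eq , m)
run-resp {σ = σ} (r , m) (store {y = y} {x}) = _ , store , (r , ↦-cong (reg σ y) m (r y) (r x))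
run-resp e (seq p q) =
  let _ , p′ , e₁ = run-resp e p
      _ , q′ , e₂ = run-resp e₁ q
  in _ , seq p′ q′ , e₂
run-resp e (ifnz-≢ x≢0 p) =
  let _ , p′ , e₁ = run-resp e p in _ , ifnz-≢ (x≢0 ∘ trans (reg≗ e _)) p′ , e₁
run-resp e (ifnz-≡ x≡0 p) =
  let _ , p′ , e₁ = run-resp e p in _ , ifnz-≡ (trans (sym (reg≗ e _)) x≡0) p′ , e₁
run-resp e (loop x≢0 p q) =
  let _ , p′ , e₁ = run-resp e p
      _ , q′ , e₂ = run-resp e₁ q
  in _ , loop (x≢0 ∘ trans (reg≗ e _)) p′ q′ , e₂
run-resp e (exit x≡0) = _ , exit (trans (sym (reg≗ e _)) x≡0) , e

-- The assumed run is bounded by the word size of the graph instance but takes place under that of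
-- the vector instance.
run-mono : ∀ {M M′ P σ τ t} → M ≤ M′ → M ⊢ P , σ ⇓[ t ] τ → M′ ⊢ P , σ ⇓[ t ] τ
run-mono h skip         = skip
run-mono h (const a)    = const (≤-trans a h)
run-mono h (arith a)    = arith (≤-trans a h)
run-mono h (load a)     = load (≤-trans a h)
run-mono h store        = store
run-mono h (seq p q)    = seq (run-mono h p) (run-mono h q)
run-mono h (ifnz-≢ x p) = ifnz-≢ x (run-mono h p)
run-mono h (ifnz-≡ x p) = ifnz-≡ x (run-mono h p)
run-mono h (loop x p q) = loop x (run-mono h p) (run-mono h q)
run-mono h (exit x)     = exit x

-- A state up to pointwise equality; the registers are given by a finite list
-- so that register lookups compute.
record Config : Set where
  constructor _▸_
  field
    regs   : List ℕ
    memory : ℕ → ℕ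
open Config

infix 4 _▸_

state : Config → State
state (vs ▸ m) = ⟨ cell vs , m ⟩

-- The time T is only an upper bound, which lets branches of different length meet. Quantifying over
-- all states pointwise equal to c is what makes sequential composition work.
record Computes (M : ℕ) (P : Program) (c : Config) (T : ℕ) (c′ : Config) : Set where
  constructor mk
  field
    run : ∀ {σ} → σ ≈ state c → ∃[ t ] ∃[ τ ] (M ⊢ P , σ ⇓[ t ] τ × t ≤ T × τ ≈ state c′)
open Computes

module _ {M : ℕ} where

  weaken : ∀ {P c c′ s t} → Computes M P c s c′ → s ≤ t → Computes M P c t c′
  weaken (mk f) s≤t .run e = let _ , _ , r , le , e′ = f e in _ , _ , r , ≤-trans le s≤t , e′

  remem : ∀ {P c vs m m′ t} → Computes M P c t (vs ▸ m) → m ≗ m′ → Computes M P c t (vs ▸ m′)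
  remem (mk f) h .run e = let _ , _ , r , le , (e₁ , e₂) = f e in
    _ , _ , r , le , (e₁ , λ j → trans (e₂ j) (h j))

  infixr 5 _⟫_
  _⟫_ : ∀ {P Q a b c s t} → Computes M P a s b → Computes M Q b t c →
        Computes M (P ⨾ Q) a (s + t) c
  (mk f ⟫ mk g) .run e =
    let _ , _ , r₁ , l₁ , e₁ = f e
        _ , _ , r₂ , l₂ , e₂ = g e₁
    in _ , _ , seq r₁ r₂ , +-mono-≤ l₁ l₂ , e₂

  skipᶜ : ∀ {c} → Computes M skip c 1 c
  skipᶜ .run e = _ , _ , skip , ≤-refl , e

  constᶜ : ∀ {vs m x a} → a ≤ M → Computes M (const x a) (vs ▸ m) 1 (upd vs x a ▸ m)
  constᶜ {vs} {x = x} {a} h .run (r , e) =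
    _ , _ , const h , ≤-refl ,
    ((λ j → trans (↦-cong x r refl refl j) (cell-upd vs x a j)) , e)

  arithᶜ : ∀ {vs m x o y z} → let a = ⟦ o ⟧ (cell vs y) (cell vs z) in
           a ≤ M → Computes M (arith x o y z) (vs ▸ m) 1 (upd vs x a ▸ m)
  arithᶜ {vs} {x = x} {o} {y} {z} h .run (r , e) =
    let eq = cong₂ ⟦ o ⟧ (r y) (r z) in
    _ , _ , arith (subst (_≤ M) (sym eq) h) , ≤-refl ,
    ((λ j → trans (↦-cong x r refl eq j) (cell-upd vs x _ j)) , e)

  loadᶜ : ∀ {vs m x y a} → m (cell vs y) ≡ a → a ≤ M →
          Computes M (load x y) (vs ▸ m) 1 (upd vs x a ▸ m)
  loadᶜ {vs} {m} {x} {y} ea h .run (r , e) =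
    let eq = trans (trans (e _) (cong m (r y))) ea in
    _ , _ , load (subst (_≤ M) (sym eq) h) , ≤-refl ,
    ((λ j → trans (↦-cong x r refl eq j) (cell-upd vs x _ j)) , e)

  storeᶜ : ∀ {vs m y x} →
           Computes M (store y x) (vs ▸ m) 1 (vs ▸ (m [ cell vs y ↦ cell vs x ]))
  storeᶜ {y = y} {x} .run {σ} (r , e) =
    _ , _ , store , ≤-refl , (r , ↦-cong (reg σ y) e (r y) (r x))

  ifnz-≢ᶜ : ∀ {P Q vs m c x t} → cell vs x ≢ 0 → Computes M P (vs ▸ m) t c →
            Computes M (ifnz x P Q) (vs ▸ m) (suc t) c
  ifnz-≢ᶜ {x = x} h (mk f) .run e = let _ , _ , r , l , e′ = f e in
    _ , _ , ifnz-≢ (h ∘ trans (sym (reg≗ e x))) r , s≤s l , e′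

  ifnz-≡ᶜ : ∀ {P Q vs m c x t} → cell vs x ≡ 0 → Computes M Q (vs ▸ m) t c →
            Computes M (ifnz x P Q) (vs ▸ m) (suc t) c
  ifnz-≡ᶜ {x = x} h (mk f) .run e = let _ , _ , r , l , e′ = f e in
    _ , _ , ifnz-≡ (trans (reg≗ e x) h) r , s≤s l , e′

  -- Instead of an invariant the whole trajectory S is prescribed. The single equation for the
  -- condition register decides both continuation and exit. Every round pays one step for its test,
  -- and the outermost `suc` is the failing test.
  whileᶜ : ∀ {P x} n (S : ℕ → Config) (T : ℕ → ℕ) →
           (∀ k → cell (regs (S k)) x ≡ bit (k <ᵇ n)) →
           (∀ k → k < n → Computes M P (S k) (T k) (S (suc k))) →
           Computes M (while x P) (S 0) (suc (sum (applyUpTo (suc ∘ T) n))) (S n)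
  whileᶜ {x = x} zero S T c b .run e =
    _ , _ , exit (trans (reg≗ e x) (c 0)) , s≤s z≤n , e
  whileᶜ {x = x} (suc n) S T c b .run e =
    let _ , _ , r₁ , l₁ , e₁ = run (b 0 z<s) e
        _ , _ , r₂ , l₂ , e₂ =
          run (whileᶜ n (S ∘ suc) (T ∘ suc) (c ∘ suc) (λ k k<n → b (suc k) (s<s k<n))) e₁
    in _ , _ , loop (λ z → 1+n≢0 (trans (sym (c 0)) (trans (sym (reg≗ e x)) z))) r₁ r₂ ,
       s≤s (≤-trans (+-mono-≤ l₁ l₂) (≤-reflexive (+-suc _ _))) , e₂

-- The state in which the simulated algorithm ends is unknown except for its answer, so a predicate
-- R replaces the final configuration.
record Halts (M : ℕ) (P : Program) (c : Config) (T : ℕ) (R : State → Set) : Set where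
  constructor mk
  field
    halt : ∀ {σ} → σ ≈ state c → ∃[ t ] ∃[ τ ] (M ⊢ P , σ ⇓[ t ] τ × t ≤ T × R τ)
open Halts

module _ {M : ℕ} where

  infixr 5 _⟫ʰ_
  _⟫ʰ_ : ∀ {P Q a b s t R} → Computes M P a s b → Halts M Q b t R → Halts M (P ⨾ Q) a (s + t) R
  (mk f ⟫ʰ mk g) .halt e =
    let _ , _ , r₁ , l₁ , e₁ = f e
        _ , _ , r₂ , l₂ , h  = g e₁
    in _ , _ , seq r₁ r₂ , +-mono-≤ l₁ l₂ , h

  ifnz-≢ʰ : ∀ {P Q vs m x t R} → cell vs x ≢ 0 → Halts M P (vs ▸ m) t R →
            Halts M (ifnz x P Q) (vs ▸ m) (suc t) R
  ifnz-≢ʰ {x = x} h (mk f) .halt e = let _ , _ , r , l , e′ = f e in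
    _ , _ , ifnz-≢ (h ∘ trans (sym (_≈_.reg≗ e x))) r , s≤s l , e′

cell-++-< : ∀ as bs {i} → i < length as → cell (as ++ bs) i ≡ cell as i
cell-++-< (a ∷ as) bs {zero}  _         = refl
cell-++-< (a ∷ as) bs {suc i} (s≤s i<n) = cell-++-< as bs i<n

cell-++-+ : ∀ as bs i → cell (as ++ bs) (length as + i) ≡ cell bs i
cell-++-+ []       bs i = refl
cell-++-+ (a ∷ as) bs i = cell-++-+ as bs i

cell-≥ : ∀ as {i} → length as ≤ i → cell as i ≡ 0
cell-≥ []       _         = refl
cell-≥ (a ∷ as) (s≤s len≤i) = cell-≥ as len≤i

cell-∷ʳ : ∀ as x → cell as [ length as ↦ x ] ≗ cell (as ∷ʳ x)
cell-∷ʳ []       x zero    = refl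
cell-∷ʳ []       x (suc j) = refl
cell-∷ʳ (a ∷ as) x zero    = refl
cell-∷ʳ (a ∷ as) x (suc j) = cell-∷ʳ as x j

length-∷ʳ : ∀ (as : List ℕ) x → length (as ∷ʳ x) ≡ suc (length as)
length-∷ʳ as x = trans (length-++ as) (+-comm (length as) 1)

cell-replicate-0 : ∀ k i → cell (replicate k 0) i ≡ 0
cell-replicate-0 zero    i       = refl
cell-replicate-0 (suc k) zero    = refl
cell-replicate-0 (suc k) (suc i) = cell-replicate-0 k i

cell≤max : ∀ as i → cell as i ≤ foldr _⊔_ 0 as
cell≤max []       i       = z≤n
cell≤max (a ∷ as) zero    = m≤m⊔n a _
cell≤max (a ∷ as) (suc i) = ≤-trans (cell≤max as i) (m≤n⊔m a _)

max≤ : ∀ {k as} → All (_≤ k) as → foldr _⊔_ 0 as ≤ k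
max≤ []       = z≤n
max≤ (h ∷ hs) = ⊔-lub h (max≤ hs)

cell≤size : ∀ as i → cell as i ≤ size as
cell≤size as i = ≤-trans (cell≤max as i) (m≤n⊔m (length as) _)

-- The program performing the reduction

Acc : Set
Acc = ℕ × List ℕ

choose : ∀ {A : Set} → ℕ → (A → A) → A → A
choose zero    f x = x
choose (suc _) f x = f x

-- One number controls the counter, the length of the output and its entries. Adding counter and
-- length means that each elementary action raises it by at most one, and that a counter may be
-- emitted as an entry.
record Fits (k : ℕ) (acc : Acc) : Set where
  constructor fits
  field
    weight : proj₁ acc + length (proj₂ acc) ≤ k
    values : All (_≤ k) (proj₂ acc)
open Fits

Fits-mono : ∀ {k l acc} → k ≤ l → Fits k acc → Fits l acc
Fits-mono k≤l (fits w v) = fits (≤-trans w k≤l) (All.map (λ x≤k → ≤-trans x≤k k≤l) v)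

-- Registers: 1 the constant 1; 2, 3 the numbers n and d; 4 the clique size D = d + 2; 5 the
-- number N of vertices; 6 the end of the output; 7, 10 the vertices v and u of the two
-- nested loops, with conditions in 8 and 11 and the limit for u in 9; 12 the number of
-- neighbours found so far; 16 the length L of the input; 0, 13, 14, 15 are scratch.
append : Reg → Program
append x = store 6 x ⨾ arith 6 add 1 6

-- For `incP` the larger vertex is in 13 and the smaller, a column, in 14. Scratch registers are
-- reset after use, so that few parameters describe the configuration of a loop.
incP flagP boundP : Program
incP =
  arith 15 sub 13 4 ⨾
  ifnz 14
    (arith 0 sub 14 1 ⨾
     ifnz 0 (arith 0 mul 15 3 ⨾ arith 0 add 0 14 ⨾ load 0 0)
            (arith 0 less 15 2 ⨾ arith 0 sub 1 0))
    (arith 0 less 15 2) ⨾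
  const 15 0
flagP =
  arith 13 sub 10 7 ⨾ arith 14 sub 10 13 ⨾ arith 13 add 7 13 ⨾
  arith 0 less 13 4 ⨾ ifnz 0 (arith 0 less 14 13) incP ⨾
  const 13 0 ⨾ const 14 0
boundP =
  -- Register 13 holds 0 at this point, so the additions are copies.
  arith 0 less 7 4 ⨾ ifnz 0 (arith 9 add 13 5) (arith 9 add 13 4) ⨾ const 0 0

scanP : Program → Program
scanP B =
  const 10 0 ⨾ arith 11 less 10 9 ⨾
  while 11 (flagP ⨾ ifnz 0 B skip ⨾ const 0 0 ⨾ arith 10 add 1 10 ⨾ arith 11 less 10 9) ⨾
  const 10 0 ⨾ const 11 0 ⨾ const 9 0

passP : Program → Program → Program
passP B A =
  const 7 0 ⨾ arith 8 less 7 5 ⨾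
  while 8 (boundP ⨾ scanP B ⨾ A ⨾ arith 7 add 1 7 ⨾ arith 8 less 7 5) ⨾
  const 7 0 ⨾ const 8 0

module Construction (as : List ℕ) (n d : ℕ) where

  D N L : ℕ
  D = 2 + d
  N = n + n + D
  L = 2 + (n * d + n * d)

  -- Whether vector r has a 1 in column c.  Columns 0 and 1 mark the vectors of X and of Y; as
  -- the first two cells of the input hold n and d, bit k of vector r lies in r * d + (2 + k).
  inc : ℕ → ℕ → ℕ
  inc r 0             = bit (r <ᵇ n)
  inc r 1             = 1 ∸ bit (r <ᵇ n)
  inc r (suc (suc k)) = cell as (r * d + suc (suc k))

  -- The maximum and the minimum, without branching.
  high low : ℕ → ℕ → ℕ
  high v u = v + (u ∸ v)
  low  v u = u ∸ (u ∸ v)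

  -- Between two columns the comparison only excludes loops. Between two rows the value is
  -- meaningless; `bound` keeps the program from asking for it, and `adjacent` masks it.
  flag : ℕ → ℕ → ℕ
  flag v u = if high v u <ᵇ D then bit (low v u <ᵇ high v u) else inc (high v u ∸ D) (low v u)

  -- Only the D clique vertices need all N candidates for a neighbour; running through N
  -- candidates for every vertex would be too slow.
  bound : ℕ → ℕ
  bound v = if v <ᵇ D then N else D

  bound≤N : ∀ v → bound v ≤ N
  bound≤N v with v <ᵇ D
  ... | true  = ≤-refl
  ... | false = m≤n+m D (n + n)

  high≤ : ∀ {v u k} → v ≤ k → u ≤ k → high v u ≤ k
  high≤ {v} {u} v≤k u≤k with ≤-total u v
  ... | inj₁ u≤v rewrite m≤n⇒m∸n≡0 u≤v | +-identityʳ v = v≤k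
  ... | inj₂ v≤u rewrite m+[n∸m]≡n v≤u = u≤k

  low≤ˡ : ∀ v u → low v u ≤ v
  low≤ˡ v u = m≤n+o⇒m∸n≤o u (u ∸ v) (≤-trans (m≤n+m∸n u v) (≤-reflexive (+-comm v (u ∸ v))))

  low≤ʳ : ∀ v u → low v u ≤ u
  low≤ʳ v u = m∸n≤m u (u ∸ v)

  -- The limit on u guarantees that the smaller of the two vertices is a column, hence below D = d +
  -- 2; so the address stays within row r of the input.
  address< : ∀ {v u} → v < N → u < bound v → (high v u <ᵇ D) ≡ false →
             (high v u ∸ D) * d + low v u < L
  address< {v} {u} v<N u<b eq = begin-strict
    r * d + low v u             <⟨ +-monoʳ-< (r * d) low<D ⟩
    r * d + (2 + d)             ≡⟨ +-comm (r * d) (2 + d) ⟩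
    2 + (d + r * d)             ≤⟨ +-monoʳ-≤ 2 (*-monoˡ-≤ d r<2n) ⟩
    2 + ((n + n) * d)           ≡⟨ cong (2 +_) (*-distribʳ-+ d n n) ⟩
    L ∎
    where
    open ≤-Reasoning
    r = high v u ∸ D
    high<N : high v u < N
    high<N = high≤ {suc v} {suc u} v<N (≤-trans u<b (bound≤N v))
    D≤high : D ≤ high v u
    D≤high = ≮⇒≥ (λ lt → subst T eq (<⇒<ᵇ lt))
    r<2n : r < n + n
    r<2n = +-cancelʳ-< D r (n + n) (subst (_< N) (sym (m∸n+n≡m D≤high)) high<N)
    low<D : low v u < D
    low<D with v <ᵇ D in e
    ... | true  = ≤-<-trans (low≤ˡ v u) (<ᵇ⇒< v D (subst T (sym e) _))
    ... | false = ≤-<-trans (low≤ʳ v u) u<b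

  cfg : (x a c r v cv bd u cu : ℕ) → Acc → Config
  cfg x a c r v cv bd u cu (s , out) =
    x ∷ 1 ∷ n ∷ d ∷ D ∷ N ∷ L + length out ∷ v ∷ cv ∷ bd ∷ u ∷ cu ∷ s ∷ a ∷ c ∷ r ∷ L ∷ []
    ▸ cell (as ++ out)

  module _ {M : ℕ} (lenAs : length as ≡ L) (as≤M : ∀ j → cell as j ≤ M)
           (2N≤M : N + N ≤ M) (L≤M : L ≤ M) where

    private
      N≤M : N ≤ M
      N≤M = ≤-trans (m≤m+n N N) 2N≤M

      D≤M : D ≤ M
      D≤M = ≤-trans (m≤n+m D (n + n)) N≤M

      1≤M : 1 ≤ M
      1≤M = ≤-trans (s≤s z≤n) D≤M

      bit≤M : ∀ b → bit b ≤ M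
      bit≤M b = ≤-trans (bit≤1 b) 1≤M

    appendᶜ : ∀ {vs out x} → cell vs 1 ≡ 1 → cell vs 6 ≡ L + length out →
              L + length (out ∷ʳ cell vs x) ≤ M →
              Computes M (append x) (vs ▸ cell (as ++ out)) 2
                (upd vs 6 (L + length (out ∷ʳ cell vs x)) ▸ cell (as ++ out ∷ʳ cell vs x))
    appendᶜ {vs} {out} {x} e₁ e₆ le =
      subst (λ p → Computes M (append x) (vs ▸ cell (as ++ out)) 2
                  (upd vs 6 p ▸ cell (as ++ out ∷ʳ cell vs x))) eq
        (remem storeᶜ stored ⟫ arithᶜ (subst (_≤ M) (sym eq) le))
      where
      eq : cell vs 1 + cell vs 6 ≡ L + length (out ∷ʳ cell vs x)
      eq rewrite e₁ | e₆ | length-∷ʳ out (cell vs x) = sym (+-suc L (length out))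
      stored : cell (as ++ out) [ cell vs 6 ↦ cell vs x ] ≗ cell (as ++ out ∷ʳ cell vs x)
      stored j = begin
        (cell (as ++ out) [ cell vs 6 ↦ cell vs x ]) j
          ≡⟨ cong (λ i → (cell (as ++ out) [ i ↦ cell vs x ]) j)
               (trans e₆ (trans (cong (_+ length out) (sym lenAs)) (sym (length-++ as)))) ⟩
        (cell (as ++ out) [ length (as ++ out) ↦ cell vs x ]) j
          ≡⟨ cell-∷ʳ (as ++ out) (cell vs x) j ⟩
        cell ((as ++ out) ∷ʳ cell vs x) j
          ≡⟨ cong (λ l → cell l j) (++-assoc as out _) ⟩
        cell (as ++ out ∷ʳ cell vs x) j ∎
        where open ≡-Reasoning

    incᶜ : ∀ {a c v cv bd u cu acc} → a ≤ M → c ≤ M → (a ∸ D) * d + c < L →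
           Computes M incP (cfg 0 a c 0 v cv bd u cu acc) 8 (cfg (inc (a ∸ D) c) a c 0 v cv bd u cu acc)
    incᶜ {a} {0} a≤M c≤M lt =
      weaken (arithᶜ (≤-trans (m∸n≤m a D) a≤M) ⟫ ifnz-≡ᶜ refl (arithᶜ (bit≤M _)) ⟫ constᶜ z≤n) (m≤m+n 4 4)
    incᶜ {a} {1} a≤M c≤M lt =
      weaken (arithᶜ (≤-trans (m∸n≤m a D) a≤M) ⟫
              ifnz-≢ᶜ (λ ()) (arithᶜ z≤n ⟫
                ifnz-≡ᶜ refl (arithᶜ (bit≤M _) ⟫ arithᶜ (≤-trans (m∸n≤m 1 (bit (a ∸ D <ᵇ n))) 1≤M))) ⟫
              constᶜ z≤n) (m≤m+n 7 1)
    incᶜ {a} {suc (suc k)} {acc = _ , out} a≤M c≤M lt =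
      weaken (arithᶜ (≤-trans (m∸n≤m a D) a≤M) ⟫
              ifnz-≢ᶜ (λ ()) (arithᶜ (≤-trans (n≤1+n _) c≤M) ⟫
                ifnz-≢ᶜ (λ ()) (arithᶜ (≤-trans (m≤m+n _ _) (≤-trans (<⇒≤ lt) L≤M)) ⟫
                  arithᶜ (≤-trans (<⇒≤ lt) L≤M) ⟫
                  loadᶜ (cell-++-< as out (subst (λ l → (a ∸ D) * d + suc (suc k) < l) (sym lenAs) lt)) (as≤M _))) ⟫
              constᶜ z≤n) ≤-refl

    flagᶜ : ∀ {v cv bd u cu acc} → v < N → u < bound v →
            Computes M flagP (cfg 0 0 0 0 v cv bd u cu acc) 15
                             (cfg (flag v u) 0 0 0 v cv bd u cu acc)
    flagᶜ {v} {cv} {bd} {u} {cu} {acc} v<N u<b =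
      arithᶜ (≤-trans (m∸n≤m u v) u≤M) ⟫ arithᶜ low≤M ⟫ arithᶜ high≤M ⟫ arithᶜ (bit≤M _) ⟫
      branch (high v u <ᵇ D) (address< v<N u<b) ⟫ constᶜ z≤n ⟫ constᶜ z≤n
      where
      u≤M : u ≤ M
      u≤M = ≤-trans (<⇒≤ u<b) (≤-trans (bound≤N v) N≤M)
      low≤M : low v u ≤ M
      low≤M = ≤-trans (low≤ʳ v u) u≤M
      high≤M : high v u ≤ M
      high≤M = high≤ (≤-trans (<⇒≤ v<N) N≤M) u≤M
      -- Stated for an arbitrary bit, so that a case split reduces the program and the target at
      -- once; the address bound is at hand only when the bit is `false`.
      branch : ∀ b → (b ≡ false → (high v u ∸ D) * d + low v u < L) →
        Computes M (ifnz 0 (arith 0 less 14 13) incP)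
          (cfg (bit b) (high v u) (low v u) 0 v cv bd u cu acc) 9
          (cfg (if b then bit (low v u <ᵇ high v u) else inc (high v u ∸ D) (low v u))
               (high v u) (low v u) 0 v cv bd u cu acc)
      branch true  _ = weaken (ifnz-≢ᶜ (λ ()) (arithᶜ (bit≤M _))) (m≤m+n 2 7)
      branch false h = ifnz-≡ᶜ refl (incᶜ high≤M low≤M (h refl))

    boundᶜ : ∀ {v cv u cu acc} →
             Computes M boundP (cfg 0 0 0 0 v cv 0 u cu acc) 4 (cfg 0 0 0 0 v cv (bound v) u cu acc)
    boundᶜ {v} {cv} {u} {cu} {acc} = arithᶜ (bit≤M _) ⟫ branch (v <ᵇ D) ⟫ constᶜ z≤n
      where
      branch : ∀ b → Computes M (ifnz 0 (arith 9 add 13 5) (arith 9 add 13 4))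
                 (cfg (bit b) 0 0 0 v cv 0 u cu acc) 2
                 (cfg (bit b) 0 0 0 v cv (if b then N else D) u cu acc)
      branch true  = ifnz-≢ᶜ (λ ()) (arithᶜ N≤M)
      branch false = ifnz-≡ᶜ refl (arithᶜ D≤M)

  -- In the encoding all offsets precede all lists, so the same pairs are visited twice: once to
  -- count neighbours and once to write them. The two passes differ only in `edge` and `after`.
  module Pass (edge : ℕ → Acc → Acc) (after : Acc → Acc) where

    inner : ℕ → ℕ → Acc → Acc
    inner v zero    acc = acc
    inner v (suc u) acc = choose (flag v u) (edge u) (inner v u acc)

    outer : ℕ → Acc → Acc
    outer zero    acc = acc
    outer (suc v) acc = after (inner v (bound v) (outer v acc))

    -- One tick for each candidate and one for each vertex. Ticks measure the running time as well
    -- as the growth of the accumulator.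
    ticks : ℕ → ℕ
    ticks m = sum (applyUpTo (suc ∘ bound) m)

    module _ (edge-fits : ∀ {k u acc} → N ≤ k → u < N → Fits k acc → Fits (suc k) (edge u acc))
             (after-fits : ∀ {k acc} → Fits k acc → Fits (suc k) (after acc)) where

      inner-fits : ∀ {k v acc} → N ≤ k → Fits k acc → ∀ u → u ≤ N → Fits (u + k) (inner v u acc)
      inner-fits N≤k f zero    _ = f
      inner-fits {v = v} N≤k f (suc u) u<N with flag v u
      ... | zero  = Fits-mono (n≤1+n _) (inner-fits N≤k f u (<⇒≤ u<N))
      ... | suc _ = edge-fits (≤-trans N≤k (m≤n+m _ u)) u<N (inner-fits N≤k f u (<⇒≤ u<N))

      outer-fits : ∀ {k acc} → N ≤ k → Fits k acc → ∀ v → Fits (ticks v + k) (outer v acc)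
      outer-fits N≤k f zero = f
      outer-fits {k} {acc} N≤k f (suc v) =
        subst (λ j → Fits j (outer (suc v) acc)) eq
          (after-fits (inner-fits {v = v} (≤-trans N≤k (m≤n+m k (ticks v))) (outer-fits N≤k f v)
                                  (bound v) (bound≤N v)))
        where
        open ≡-Reasoning
        eq : suc (bound v + (ticks v + k)) ≡ ticks (suc v) + k
        eq = begin
          suc (bound v) + (ticks v + k)  ≡⟨ +-assoc (suc (bound v)) (ticks v) k ⟨
          suc (bound v) + ticks v + k    ≡⟨ cong (_+ k) (+-comm (suc (bound v)) (ticks v)) ⟩
          ticks v + suc (bound v) + k    ≡⟨ cong (_+ k) (sum-applyUpTo-suc (suc ∘ bound) v) ⟨
          ticks (suc v) + k ∎

      module _ {M : ℕ} (lenAs : length as ≡ L) (as≤M : ∀ j → cell as j ≤ M)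
               (2N≤M : N + N ≤ M) (L≤M : L ≤ M)
               {k₀ : ℕ} (N≤k₀ : N ≤ k₀) (B A : Program)
               (edgeᶜ : ∀ {x v cv bd u cu acc} → u < N → Fits (ticks N + k₀) (edge u acc) →
                  Computes M B (cfg x 0 0 0 v cv bd u cu acc) 3 (cfg x 0 0 0 v cv bd u cu (edge u acc)))
               (afterᶜ : ∀ {v cv acc} → Fits (ticks N + k₀) (after acc) →
                  Computes M A (cfg 0 0 0 0 v cv 0 0 0 acc) 3 (cfg 0 0 0 0 v cv 0 0 0 (after acc)))
               where

        private
          N≤M : N ≤ M
          N≤M = ≤-trans (m≤m+n N N) 2N≤M

          1≤M : 1 ≤ M
          1≤M = ≤-trans (≤-trans (s≤s z≤n) (m≤n+m D (n + n))) N≤M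

        scanᶜ : ∀ {v cv k acc} → v < N → N ≤ k → bound v + k ≤ ticks N + k₀ → Fits k acc →
                Computes M (scanP B) (cfg 0 0 0 0 v cv (bound v) 0 0 acc) (6 + bound v * 23)
                                     (cfg 0 0 0 0 v cv 0 0 0 (inner v (bound v) acc))
        scanᶜ {v} {cv} {k} {acc} v<N N≤k le f =
          weaken
            (constᶜ z≤n ⟫ arithᶜ (≤-trans (bit≤1 _) 1≤M) ⟫
             whileᶜ (bound v) S (λ _ → 22) (λ _ → refl) body ⟫
             constᶜ z≤n ⟫ constᶜ z≤n ⟫ constᶜ z≤n)
            (≤-reflexive (trans (cong (λ s → 3 + (s + 3)) (sum-applyUpTo-const 23 (bound v)))
                                (cong (3 +_) (+-comm _ 3))))
          where
          S : ℕ → Config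
          S u = cfg 0 0 0 0 v cv (bound v) u (bit (u <ᵇ bound v)) (inner v u acc)
          select : ∀ {u cu} x → u < bound v → inner v (suc u) acc ≡ choose x (edge u) (inner v u acc) →
            Computes M (ifnz 0 B skip) (cfg x 0 0 0 v cv (bound v) u cu (inner v u acc)) 4
                       (cfg x 0 0 0 v cv (bound v) u cu (choose x (edge u) (inner v u acc)))
          select zero    _   _  = weaken (ifnz-≡ᶜ refl skipᶜ) (m≤m+n 2 2)
          select {u} (suc _) u<b eq = ifnz-≢ᶜ (λ ())
            (edgeᶜ (<-≤-trans u<b (bound≤N v))
                   (subst (Fits _) eq (Fits-mono (≤-trans (+-monoˡ-≤ k u<b) le)
                     (inner-fits {v = v} N≤k f (suc u) (≤-trans u<b (bound≤N v))))))
          body : ∀ u → u < bound v → Computes M _ (S u) 22 (S (suc u))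
          body u u<b =
            flagᶜ lenAs as≤M 2N≤M L≤M v<N u<b ⟫ select (flag v u) u<b refl ⟫ constᶜ z≤n ⟫
            arithᶜ (≤-trans (≤-trans u<b (bound≤N v)) N≤M) ⟫ arithᶜ (≤-trans (bit≤1 _) 1≤M)

        passᶜ : ∀ {acc} → Fits k₀ acc →
                Computes M (passP B A) (cfg 0 0 0 0 0 0 0 0 0 acc) (5 + 23 * ticks N)
                                       (cfg 0 0 0 0 0 0 0 0 0 (outer N acc))
        passᶜ {acc} f =
          weaken
            (constᶜ z≤n ⟫ arithᶜ (≤-trans (bit≤1 _) 1≤M) ⟫
             whileᶜ N S (λ v → 15 + bound v * 23) (λ _ → refl) body ⟫
             constᶜ z≤n ⟫ constᶜ z≤n)
            (≤-trans (+-monoʳ-≤ 3 (+-monoˡ-≤ 2 (sum-applyUpTo-≤ {g = suc ∘ bound} 23 N time)))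
                     (≤-reflexive (cong (3 +_) (+-comm _ 2))))
          where
          -- A candidate costs 22 steps and a loop test; the overhead of 16 for a vertex is covered
          -- by the 23 steps of its own tick.
          time : ∀ v → 16 + bound v * 23 ≤ 23 * suc (bound v)
          time v = begin
            16 + bound v * 23   ≤⟨ +-monoˡ-≤ _ (m≤m+n 16 7) ⟩
            23 + bound v * 23   ≡⟨ *-comm (suc (bound v)) 23 ⟩
            23 * suc (bound v)  ∎
            where open ≤-Reasoning
          S : ℕ → Config
          S v = cfg 0 0 0 0 v (bit (v <ᵇ N)) 0 0 0 (outer v acc)
          ticks-mono : ∀ {v m} → v ≤′ m → ticks v ≤ ticks m
          ticks-mono ≤′-refl = ≤-refl
          ticks-mono {m = suc m} (≤′-step h) = ≤-trans (ticks-mono h)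
            (≤-trans (m≤m+n _ _) (≤-reflexive (sym (sum-applyUpTo-suc (suc ∘ bound) m))))
          capacity : ∀ {v} → v < N → suc (bound v) + (ticks v + k₀) ≤ ticks N + k₀
          capacity {v} v<N = begin
            suc (bound v) + (ticks v + k₀)  ≡⟨ +-assoc (suc (bound v)) (ticks v) k₀ ⟨
            suc (bound v) + ticks v + k₀    ≡⟨ cong (_+ k₀) (+-comm (suc (bound v)) (ticks v)) ⟩
            ticks v + suc (bound v) + k₀    ≡⟨ cong (_+ k₀) (sum-applyUpTo-suc (suc ∘ bound) v) ⟨
            ticks (suc v) + k₀              ≤⟨ +-monoˡ-≤ k₀ (ticks-mono (≤⇒≤′ v<N)) ⟩
            ticks N + k₀                    ∎
            where open ≤-Reasoning
          body : ∀ v → v < N → Computes M _ (S v) (15 + bound v * 23) (S (suc v))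
          body v v<N =
            weaken
              (boundᶜ lenAs as≤M 2N≤M L≤M ⟫
               scanᶜ v<N (≤-trans N≤k₀ (m≤n+m k₀ (ticks v))) (<⇒≤ (capacity v<N)) (outer-fits N≤k₀ f v) ⟫
               afterᶜ (Fits-mono (+-monoˡ-≤ k₀ (ticks-mono (≤⇒≤′ v<N))) (outer-fits N≤k₀ f (suc v))) ⟫
               arithᶜ (≤-trans v<N N≤M) ⟫ arithᶜ (≤-trans (bit≤1 _) 1≤M))
              (≤-reflexive (cong (4 +_) (trans (+-comm (6 + bound v * 23) 5) refl)))

-- The graph is written behind the input.  Shifting all of memory down by L cells then moves
-- it into place and clears the cells behind it, since what is shifted in there is 0.
sizesP headerP shiftP clearP transformP : Program
sizesP =
  const 0 2 ⨾ arith 4 add 0 3 ⨾ arith 5 add 2 2 ⨾ arith 5 add 5 4 ⨾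
  arith 6 mul 2 3 ⨾ arith 6 add 6 6 ⨾ arith 6 add 0 6 ⨾ arith 16 add 15 6
headerP =
  -- The counter 12 is still 0 and supplies the first offset.
  append 5 ⨾ const 0 4 ⨾ arith 0 sub 5 0 ⨾ append 0 ⨾ append 12 ⨾ const 0 0
shiftP =
  const 7 0 ⨾ arith 8 less 7 6 ⨾
  while 8 (arith 13 add 7 16 ⨾ load 13 13 ⨾ store 7 13 ⨾ const 13 0 ⨾
           arith 7 add 1 7 ⨾ arith 8 less 7 6)
clearP =
  const 1 0 ⨾ const 2 0 ⨾ const 3 0 ⨾ const 4 0 ⨾ const 5 0 ⨾ const 6 0 ⨾ const 7 0 ⨾
  const 8 0 ⨾ const 12 0 ⨾ const 16 0
transformP =
  sizesP ⨾ headerP ⨾ passP (arith 12 add 1 12) (append 12) ⨾ passP (append 10) skip ⨾ shiftP ⨾ clearP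

-- For n = 0 the program stops with 0 in register 0, that is, it rejects.
reductionP : Program → Program
reductionP P = const 1 1 ⨾ load 2 0 ⨾ load 3 1 ⨾ ifnz 2 (transformP ⨾ P) skip

zeros : List ℕ
zeros = replicate 17 0

-- Correctness and cost of the program writing the graph

module Transformation (as : List ℕ) (n d : ℕ) where

  open Construction as n d

  countEdge : ℕ → Acc → Acc
  countEdge _ (s , out) = suc s , out

  emitCount : Acc → Acc
  emitCount (s , out) = s , out ∷ʳ s

  emitEdge : ℕ → Acc → Acc
  emitEdge u (s , out) = s , out ∷ʳ u

  module Offsets = Pass countEdge emitCount
  module Edges   = Pass emitEdge id

  start counted emitted : Acc
  start   = 0 , N ∷ (N ∸ 4) ∷ 0 ∷ []
  counted = Offsets.outer N start
  emitted = Edges.outer N counted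

  output : List ℕ
  output = proj₂ emitted

  -- The header fits into 3 + N and each pass adds at most one per tick, so F bounds the length and
  -- the entries of the final output.
  K F : ℕ
  K = Offsets.ticks N
  F = K + (K + (3 + N))

  countEdge-fits : ∀ {k u acc} → N ≤ k → u < N → Fits k acc → Fits (suc k) (countEdge u acc)
  countEdge-fits _ _ (fits w v) = fits (s≤s w) (All.map m≤n⇒m≤1+n v)

  emitCount-fits : ∀ {k acc} → Fits k acc → Fits (suc k) (emitCount acc)
  emitCount-fits {acc = s , out} (fits w v) =
    fits (≤-trans (≤-reflexive (trans (cong (s +_) (length-∷ʳ out s)) (+-suc s _))) (s≤s w))
         (∷ʳ⁺ (All.map m≤n⇒m≤1+n v) (m≤n⇒m≤1+n (m+n≤o⇒m≤o s w)))

  emitEdge-fits : ∀ {k u acc} → N ≤ k → u < N → Fits k acc → Fits (suc k) (emitEdge u acc)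
  emitEdge-fits {u = u} {s , out} N≤k u<N (fits w v) =
    fits (≤-trans (≤-reflexive (trans (cong (s +_) (length-∷ʳ out u)) (+-suc s _))) (s≤s w))
         (∷ʳ⁺ (All.map m≤n⇒m≤1+n v) (m≤n⇒m≤1+n (≤-trans (<⇒≤ u<N) N≤k)))

  start-fits : Fits (3 + N) start
  start-fits = fits (m≤m+n 3 N) (m≤n+m N 3 ∷ ≤-trans (m∸n≤m N 4) (m≤n+m N 3) ∷ z≤n ∷ [])

  counted-fits : Fits (K + (3 + N)) counted
  counted-fits = Offsets.outer-fits countEdge-fits emitCount-fits (m≤n+m N 3) start-fits N

  N≤K+3+N : N ≤ K + (3 + N)
  N≤K+3+N = ≤-trans (m≤n+m N 3) (m≤n+m (3 + N) K)

  emitted-fits : Fits F emitted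
  emitted-fits = Edges.outer-fits emitEdge-fits (Fits-mono (n≤1+n _)) N≤K+3+N counted-fits N

  module _ {M : ℕ} (lenAs : length as ≡ L) (as≤M : ∀ j → cell as j ≤ M)
           (2N≤M : N + N ≤ M) (cap : L + (L + F) ≤ M) where

    private
      L≤M : L ≤ M
      L≤M = m+n≤o⇒m≤o L cap

      F≤M : F ≤ M
      F≤M = m+n≤o⇒n≤o L (m+n≤o⇒n≤o L cap)

      end≤M : ∀ {k s out} → k ≤ F → Fits k (s , out) → L + length out ≤ M
      end≤M {s = s} k≤F f = ≤-trans (+-monoʳ-≤ L (≤-trans (m+n≤o⇒n≤o s (weight f)) k≤F))
                              (m+n≤o⇒n≤o L cap)

      F′≤F : K + (3 + N) ≤ F
      F′≤F = m≤n+m _ K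

      3+N≤M : 3 + N ≤ M
      3+N≤M = ≤-trans (≤-trans (m≤n+m (3 + N) K) F′≤F) F≤M

      N≤M : N ≤ M
      N≤M = ≤-trans (m≤n+m N 3) 3+N≤M

      D≤N : D ≤ N
      D≤N = m≤n+m D (n + n)

      4≤M : 4 ≤ M
      4≤M = ≤-trans (+-monoʳ-≤ 3 (≤-trans (s≤s z≤n) D≤N)) 3+N≤M

      2nd≤M : n * d + n * d ≤ M
      2nd≤M = ≤-trans (m≤n+m _ 2) L≤M

      L+≤M : ∀ k → k ≤ 3 → L + k ≤ M
      L+≤M k k≤3 = ≤-trans (+-monoʳ-≤ L (≤-trans k≤3 (≤-trans (m≤m+n 3 N) (≤-trans (m≤n+m _ K) F′≤F))))
                     (m+n≤o⇒n≤o L cap)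

    sizesᶜ : Computes M sizesP
      (0 ∷ 1 ∷ n ∷ d ∷ 0 ∷ 0 ∷ 0 ∷ 0 ∷ 0 ∷ 0 ∷ 0 ∷ 0 ∷ 0 ∷ 0 ∷ 0 ∷ 0 ∷ 0 ∷ [] ▸ cell as) 8
      (2 ∷ 1 ∷ n ∷ d ∷ D ∷ N ∷ L ∷ 0 ∷ 0 ∷ 0 ∷ 0 ∷ 0 ∷ 0 ∷ 0 ∷ 0 ∷ 0 ∷ L ∷ [] ▸ cell (as ++ []))
    sizesᶜ =
      constᶜ (≤-trans (m≤m+n 2 2) 4≤M) ⟫ arithᶜ (≤-trans D≤N N≤M) ⟫
      arithᶜ (≤-trans (m≤m+n (n + n) D) N≤M) ⟫ arithᶜ N≤M ⟫
      arithᶜ (m+n≤o⇒m≤o (n * d) 2nd≤M) ⟫ arithᶜ 2nd≤M ⟫ arithᶜ L≤M ⟫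
      remem (arithᶜ L≤M) (λ j → cong (λ l → cell l j) (sym (++-identityʳ as)))

    headerᶜ : Computes M headerP
      (2 ∷ 1 ∷ n ∷ d ∷ D ∷ N ∷ L ∷ 0 ∷ 0 ∷ 0 ∷ 0 ∷ 0 ∷ 0 ∷ 0 ∷ 0 ∷ 0 ∷ L ∷ [] ▸ cell (as ++ [])) 9
      (cfg 0 0 0 0 0 0 0 0 0 start)
    headerᶜ =
      appendᶜ lenAs as≤M 2N≤M L≤M {out = []} refl (sym (+-identityʳ L)) (L+≤M 1 (m≤m+n 1 2)) ⟫
      constᶜ 4≤M ⟫ arithᶜ (≤-trans (m∸n≤m N 4) N≤M) ⟫
      appendᶜ lenAs as≤M 2N≤M L≤M {out = N ∷ []} refl refl (L+≤M 2 (m≤m+n 2 1)) ⟫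
      appendᶜ lenAs as≤M 2N≤M L≤M {out = N ∷ (N ∸ 4) ∷ []} refl refl (L+≤M 3 ≤-refl) ⟫
      constᶜ z≤n

    offsetsᶜ : Computes M (passP (arith 12 add 1 12) (append 12))
                 (cfg 0 0 0 0 0 0 0 0 0 start) (5 + 23 * K) (cfg 0 0 0 0 0 0 0 0 0 counted)
    offsetsᶜ = Offsets.passᶜ countEdge-fits emitCount-fits lenAs as≤M 2N≤M L≤M (m≤n+m N 3) _ _
      (λ {_} {_} {_} {_} {_} {_} {acc} _ f →
         weaken (arithᶜ (≤-trans (m+n≤o⇒m≤o (suc (proj₁ acc)) (weight f)) (≤-trans F′≤F F≤M))) (m≤m+n 1 2))
      (λ f → weaken (appendᶜ lenAs as≤M 2N≤M L≤M refl refl (end≤M F′≤F f)) (m≤m+n 2 1))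
      start-fits

    edgesᶜ : Computes M (passP (append 10) skip)
               (cfg 0 0 0 0 0 0 0 0 0 counted) (5 + 23 * K) (cfg 0 0 0 0 0 0 0 0 0 emitted)
    edgesᶜ = Edges.passᶜ emitEdge-fits (Fits-mono (n≤1+n _)) lenAs as≤M 2N≤M L≤M N≤K+3+N _ _
      (λ _ f → weaken (appendᶜ lenAs as≤M 2N≤M L≤M refl refl (end≤M ≤-refl f)) (m≤m+n 2 1))
      (λ _ → weaken skipᶜ (m≤m+n 1 2))
      counted-fits

    module _ (s : ℕ) (out : List ℕ) (f : Fits F (s , out)) where

      private
        all : List ℕ
        all = as ++ out

        p : ℕ
        p = L + length out

      -- The memory once i cells have been moved. The cell at i + L read next is not below i, hence
      -- still holds its original value.
      shifted : ℕ → ℕ → ℕ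
      shifted i j = if j <ᵇ i then cell all (j + L) else cell all j

      shifted-suc : ∀ i → shifted i [ i ↦ cell all (i + L) ] ≗ shifted (suc i)
      shifted-suc i j with <-cmp j i
      ... | tri< j<i j≢i _ rewrite ≡ᵇ-false (≢-sym j≢i) | <ᵇ-true j<i | <ᵇ-true (m≤n⇒m≤1+n j<i) = refl
      ... | tri≈ _ refl _  rewrite ≡ᵇ-refl j | <ᵇ-true (n<1+n j) = refl
      ... | tri> _ j≢i i<j rewrite ≡ᵇ-false (≢-sym j≢i) | <ᵇ-false (<⇒≤ i<j) | <ᵇ-false i<j = refl

      cell-out : ∀ j → cell all (j + L) ≡ cell out j
      cell-out j = trans (cong (cell all) (trans (+-comm j L) (cong (_+ j) (sym lenAs)))) (cell-++-+ as out j)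

      shifted-all : shifted p ≗ cell out
      shifted-all j with <-≤-connex j p
      ... | inj₁ j<p rewrite <ᵇ-true j<p = cell-out j
      ... | inj₂ p≤j rewrite <ᵇ-false p≤j =
        trans (cell-≥ all (≤-trans (≤-reflexive (trans (length-++ as) (cong (_+ length out) lenAs))) p≤j))
              (sym (cell-≥ out (≤-trans (m≤n+m _ L) p≤j)))

      cell≤ : ∀ {k} {xs : List ℕ} → All (_≤ k) xs → ∀ i → cell xs i ≤ k
      cell≤ []       i       = z≤n
      cell≤ (h ∷ hs) zero    = h
      cell≤ (h ∷ hs) (suc i) = cell≤ hs i

      shiftᶜ : Computes M (shiftP ⨾ clearP) (cfg 0 0 0 0 0 0 0 0 0 (s , out))
                 (13 + 7 * (L + F)) (zeros ▸ cell out)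
      shiftᶜ = weaken
        ((constᶜ z≤n ⟫ arithᶜ (≤-trans (bit≤1 _) (≤-trans (s≤s z≤n) 4≤M)) ⟫
          remem (whileᶜ p S (λ _ → 6) (λ _ → refl) body) shifted-all) ⟫
         constᶜ z≤n ⟫ constᶜ z≤n ⟫ constᶜ z≤n ⟫ constᶜ z≤n ⟫ constᶜ z≤n ⟫ constᶜ z≤n ⟫
         constᶜ z≤n ⟫ constᶜ z≤n ⟫ constᶜ z≤n ⟫ constᶜ z≤n)
        time
        where
        S : ℕ → Config
        S i = 0 ∷ 1 ∷ n ∷ d ∷ D ∷ N ∷ p ∷ i ∷ bit (i <ᵇ p) ∷ 0 ∷ 0 ∷ 0 ∷ s ∷ 0 ∷ 0 ∷ 0 ∷ L ∷ []
              ▸ shifted i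
        p≤M : p ≤ M
        p≤M = end≤M ≤-refl f
        time : 3 + sum (applyUpTo (λ _ → 7) p) + 10 ≤ 13 + 7 * (L + F)
        time = begin
          3 + sum (applyUpTo (λ _ → 7) p) + 10  ≡⟨ +-comm _ 10 ⟩
          13 + sum (applyUpTo (λ _ → 7) p)      ≡⟨ cong (13 +_) (sum-applyUpTo-const 7 p) ⟩
          13 + p * 7                            ≡⟨ cong (13 +_) (*-comm p 7) ⟩
          13 + 7 * p                            ≤⟨ +-monoʳ-≤ 13 (*-monoʳ-≤ 7 (+-monoʳ-≤ L
                                                     (m+n≤o⇒n≤o s (weight f)))) ⟩
          13 + 7 * (L + F)                      ∎
          where open ≤-Reasoning
        source : ∀ i → shifted i (i + L) ≡ cell all (i + L)
        source i rewrite <ᵇ-false (m≤m+n i L) = refl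
        body : ∀ i → i < p → Computes M _ (S i) 6 (S (suc i))
        -- Source addresses run up to p + L, beyond the end of the output; this is why `cap` counts
        -- L twice.
        body i i<p =
          arithᶜ (≤-trans (+-monoˡ-≤ L (<⇒≤ i<p))
                   (≤-trans (≤-reflexive (+-comm p L))
                     (≤-trans (+-monoʳ-≤ L (+-monoʳ-≤ L (m+n≤o⇒n≤o s (weight f)))) cap))) ⟫
          loadᶜ (source i)
            (≤-trans (≤-reflexive (cell-out i)) (≤-trans (cell≤ (values f) i) F≤M)) ⟫
          remem storeᶜ (shifted-suc i) ⟫ constᶜ z≤n ⟫
          arithᶜ (≤-trans i<p p≤M) ⟫ arithᶜ (≤-trans (bit≤1 _) (≤-trans (s≤s z≤n) 4≤M))

    transformᶜ : Computes M transformP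
      (0 ∷ 1 ∷ n ∷ d ∷ 0 ∷ 0 ∷ 0 ∷ 0 ∷ 0 ∷ 0 ∷ 0 ∷ 0 ∷ 0 ∷ 0 ∷ 0 ∷ 0 ∷ 0 ∷ [] ▸ cell as)
      (17 + (5 + 23 * K + (5 + 23 * K + (13 + 7 * (L + F)))))
      (zeros ▸ cell output)
    transformᶜ = sizesᶜ ⟫ headerᶜ ⟫ offsetsᶜ ⟫ edgesᶜ ⟫ shiftᶜ (proj₁ emitted) output emitted-fits

-- Graphs

open import Data.Fin.Base as Fin using (Fin; zero; suc; toℕ; fromℕ<; punchIn; punchOut)
open import Data.Fin.Patterns using (0F; 1F; 2F; 3F; 4F)
open import Data.Fin.Permutation using (permutation; _⟨$⟩ʳ_; _⟨$⟩ˡ_; inverseʳ; inverseˡ)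
import Data.Fin.Properties as Fin
open import Data.Fin.Subset using (Subset; _∈_; ∣_∣; _∪_; ⁅_⁆)
open import Data.Fin.Subset.Properties using (x∈p∪q⁺; x∈p∪q⁻; x∈⁅x⁆; ∣⁅x⁆∣≡1; x∈⁅y⁆⇒x≡y)
open import Data.Vec.Base as Vec using (Vec; []; _∷_; lookup; toList)
open import Data.Vec.Properties using (length-toList; lookup∘tabulate; lookup⇒[]=)

module _ {n} (G : Graph n) where

  Adj-sym : ∀ {u v} → Adj G u v → Adj G v u
  Adj-sym {u} {v} = subst T (adj-sym G u v)

  Adj-irrefl : ∀ {v} → ¬ Adj G v v
  Adj-irrefl {v} = subst T (irrefl G v)

  Adj⇒≢ : ∀ {u v} → Adj G u v → u ≢ v
  Adj⇒≢ uv refl = Adj-irrefl uv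

-- Edge contractions and partitions into a path

module _ {n} (G : Graph (suc n)) {u v : Fin (suc n)} (uv : Adj G u v) where

  private
    v≢u : v ≢ u
    v≢u = ≢-sym (Adj⇒≢ G uv)

  collapse : Fin (suc n) → Fin n
  collapse w with v Fin.≟ w
  ... | yes _  = punchOut v≢u
  ... | no v≢w = punchOut v≢w

  collapse-other : ∀ {w} → v ≢ w → punchIn v (collapse w) ≡ w
  collapse-other {w} v≢w with v Fin.≟ w
  ... | yes v≡w = contradiction v≡w v≢w
  ... | no v≢w′ = Fin.punchIn-punchOut v≢w′

  collapse-v : punchIn v (collapse v) ≡ u
  collapse-v with v Fin.≟ v
  ... | yes _  = Fin.punchIn-punchOut v≢u
  ... | no v≢v = contradiction refl v≢v

  collapse-punchIn : ∀ i → collapse (punchIn v i) ≡ i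
  collapse-punchIn i = Fin.punchIn-injective v _ _ (collapse-other (≢-sym (Fin.punchInᵢ≢i v i)))

  private
    _~_ : Fin (suc n) → Fin (suc n) → Set
    a ~ b = Adj G a b ⊎ (a ≡ u × Adj G v b) ⊎ (b ≡ u × Adj G v a)

  contract-adj⁻ : ∀ {i j} → Adj (contract G u v) i j → punchIn v i ~ punchIn v j
  contract-adj⁻ {i} {j} h with to (T-∨ {adj G (punchIn v i) (punchIn v j)}) (proj₂ (to T-∧ h))
  ... | inj₁ ab = inj₁ ab
  ... | inj₂ h′ with to (T-∨ {⌊ punchIn v i Fin.≟ u ⌋ ∧ adj G v (punchIn v j)}) h′
  ...   | inj₁ h″ = let eq , vb = to (T-∧ {⌊ punchIn v i Fin.≟ u ⌋}) h″ in inj₂ (inj₁ (toWitness eq , vb))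
  ...   | inj₂ h″ = let eq , va = to (T-∧ {⌊ punchIn v j Fin.≟ u ⌋}) h″ in inj₂ (inj₂ (toWitness eq , va))

  contract-adj⁺ : ∀ {i j} → i ≢ j → punchIn v i ~ punchIn v j → Adj (contract G u v) i j
  contract-adj⁺ {i} {j} i≢j h = from T-∧ (distinct , from (T-∨ {adj G a b}) (split h))
    where
    a = punchIn v i
    b = punchIn v j
    distinct : T (not ⌊ i Fin.≟ j ⌋)
    distinct with i Fin.≟ j
    ... | yes i≡j = i≢j i≡j
    ... | no _    = _
    split : a ~ b → T (adj G a b) ⊎ T ((⌊ a Fin.≟ u ⌋ ∧ adj G v b) ∨ (⌊ b Fin.≟ u ⌋ ∧ adj G v a))
    split (inj₁ ab)               = inj₁ ab
    split (inj₂ (inj₁ (a≡u , vb))) =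
      inj₂ (from (T-∨ {⌊ a Fin.≟ u ⌋ ∧ adj G v b}) (inj₁ (from T-∧ (fromWitness a≡u , vb))))
    split (inj₂ (inj₂ (b≡u , va))) =
      inj₂ (from (T-∨ {⌊ a Fin.≟ u ⌋ ∧ adj G v b}) (inj₂ (from T-∧ (fromWitness b≡u , va))))

  collapse-adj : ∀ {a b} → Adj G a b →
                 collapse a ≡ collapse b ⊎ Adj (contract G u v) (collapse a) (collapse b)
  collapse-adj {a} {b} ab = decide (collapse a Fin.≟ collapse b)
    where
    lift : _ → _ → punchIn v (collapse a) ~ punchIn v (collapse b)
    lift (yes refl) (yes refl) = contradiction ab (Adj-irrefl G)
    lift (yes refl) (no v≢b)   =
      inj₂ (inj₁ (collapse-v , subst (Adj G v) (sym (collapse-other v≢b)) ab))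
    lift (no v≢a)   (yes refl) =
      inj₂ (inj₂ (collapse-v , subst (Adj G v) (sym (collapse-other v≢a)) (Adj-sym G ab)))
    lift (no v≢a)   (no v≢b)   =
      inj₁ (subst₂ (Adj G) (sym (collapse-other v≢a)) (sym (collapse-other v≢b)) ab)
    decide : Dec (collapse a ≡ collapse b) → _
    decide (yes eq) = inj₁ eq
    decide (no neq) = inj₂ (contract-adj⁺ neq (lift (v Fin.≟ a) (v Fin.≟ b)))

PathAdj-sym : ∀ {m} {i j : Fin m} → PathAdj i j → PathAdj j i
PathAdj-sym = Sum.swap

PathAdj-irrefl : ∀ {m} {i : Fin m} → ¬ PathAdj i i
PathAdj-irrefl (inj₁ eq) = 1+n≢n eq
PathAdj-irrefl (inj₂ eq) = 1+n≢n eq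

-- The map is the composite of the quotient maps `collapse`, and every contraction removes exactly
-- one vertex.
contraction-map : ∀ {n m k} {G : Graph n} {H : Graph m} → G ⟶[ k ] H →
  n ≡ k + m × Σ (Fin n → Fin m) λ f → (∀ j → ∃[ v ] f v ≡ j) ×
                                      (∀ {u v} → Adj G u v → f u ≡ f v ⊎ Adj H (f u) (f v))
contraction-map done = refl , id , (λ j → j , refl) , inj₂
contraction-map {G = G} (step u v uv r) =
  let eq , f , onto , hom = contraction-map r
  in cong suc eq , f ∘ collapse G uv ,
     (λ j → let w , e = onto j in punchIn v w , trans (cong f (collapse-punchIn G uv w)) e) ,
     λ ab → [ inj₁ ∘ cong f , hom ]′ (collapse-adj G uv ab)

path-map : ∀ {n k m} {G : Graph n} {H : Graph m} → G ⟶[ k ] H → IsPath H →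
  n ≡ k + m × Σ (Fin n → Fin m) λ f → (∀ j → ∃[ v ] f v ≡ j) ×
                                      (∀ {u v} → Adj G u v → f u ≡ f v ⊎ PathAdj (f u) (f v))
path-map {H = H} r (_ , π , path) =
  let eq , f , onto , hom = contraction-map r
  in eq , (π ⟨$⟩ˡ_) ∘ f ,
     (λ j → let v , e = onto (π ⟨$⟩ʳ j) in v , trans (cong (π ⟨$⟩ˡ_) e) (inverseˡ π)) ,
     λ uv → [ inj₁ ∘ cong (π ⟨$⟩ˡ_) ,
              (λ e → inj₂ (to (path _ _) (subst₂ (Adj H) (sym (inverseʳ π)) (sym (inverseʳ π)) e))) ]′
            (hom uv)

-- This is a witness structure for contraction to a path: the fibres are connected parts, and
-- distinct parts are adjacent exactly when they are consecutive.
record PathPartition {n} (G : Graph n) {m} (φ : Fin n → Fin m) : Set where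
  field
    onto   : ∀ j → ∃[ v ] φ v ≡ j
    fibres : ∀ {u v} → φ u ≡ φ v → Star (λ a b → Adj G a b × φ a ≡ φ b) u v
    local  : ∀ {u v} → Adj G u v → φ u ≡ φ v ⊎ PathAdj (φ u) (φ v)
    linked : ∀ {i j} → PathAdj i j → ∃[ u ] ∃[ v ] (φ u ≡ i × φ v ≡ j × Adj G u v)

open PathPartition

bijective-path : ∀ {m} {G : Graph m} {φ : Fin m → Fin m} → 1 ≤ m → PathPartition G φ → IsPath G
bijective-path {m} {G} {φ} 1≤m P = 1≤m , permutation g φ gφ φg , λ i j → mk⇔ (fw i j) bw
  where
  g : Fin m → Fin m
  g j = proj₁ (onto P j)
  φg : ∀ j → φ (g j) ≡ j
  φg j = proj₂ (onto P j)
  g-injective : ∀ {i j} → g i ≡ g j → i ≡ j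
  g-injective {i} {j} e = trans (sym (φg i)) (trans (cong φ e) (φg j))
  -- A vertex missed by the section g would, together with the image of g, give m + 1 distinct
  -- elements of `Fin m`.
  gφ : ∀ v → g (φ v) ≡ v
  gφ v with g (φ v) Fin.≟ v
  ... | yes e = e
  ... | no ne = contradiction (Fin.injective⇒≤ extended-injective) 1+n≰n
    where
    extended : Fin (suc m) → Fin m
    extended zero    = v
    extended (suc i) = g i
    missed : ∀ {i} → v ≢ g i
    missed {i} refl = ne (cong g (φg i))
    extended-injective : ∀ {x y} → extended x ≡ extended y → x ≡ y
    extended-injective {zero}  {zero}  _ = refl
    extended-injective {zero}  {suc y} e = contradiction e missed
    extended-injective {suc x} {zero}  e = contradiction (sym e) missed
    extended-injective {suc x} {suc y} e = cong suc (g-injective e)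
  fw : ∀ i j → Adj G (g i) (g j) → PathAdj i j
  fw i j e with local P e
  ... | inj₂ p  = subst₂ PathAdj (φg i) (φg j) p
  ... | inj₁ eq = contradiction (subst (λ k → Adj G (g i) (g k)) (sym i≡j) e) (Adj-irrefl G)
    where
    i≡j : i ≡ j
    i≡j = trans (sym (φg i)) (trans eq (φg j))
  bw : ∀ {i j} → PathAdj i j → Adj G (g i) (g j)
  bw p with u , v , refl , refl , e ← linked P p = subst₂ (Adj G) (sym (gφ u)) (sym (gφ v)) e

-- While there are more vertices than parts, two vertices share a part. The first edge of a walk
-- joining them inside it can be contracted, and φ descends to the quotient.
partition-contracts : ∀ k {n m} {G : Graph n} {φ : Fin n → Fin m} → n ≡ k + m → 1 ≤ m →
  PathPartition G φ → ∃[ m′ ] Σ (Graph m′) λ H → (G ⟶[ k ] H) × IsPath H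
partition-contracts zero    refl 1≤m P = _ , _ , done , bijective-path 1≤m P
partition-contracts (suc k) {m = m} {G} {φ} refl 1≤m P
  with a , b , a<b , φa≡φb ← Fin.pigeonhole (s≤s (m≤n+m m k)) φ
  with fibres P φa≡φb
... | ε = contradiction refl (Fin.<⇒≢ a<b)
... | _◅_ {j = w} (aw , φa≡φw) _ =
  let m′ , H , r , path = partition-contracts k refl 1≤m contracted in m′ , H , step a w aw r , path
  where
  q = collapse G aw
  ψ : Fin (k + m) → Fin m
  ψ i = φ (punchIn w i)
  ψq : ∀ c → ψ (q c) ≡ φ c
  ψq c with w Fin.≟ c
  ... | yes refl = trans (cong φ (Fin.punchIn-punchOut _)) φa≡φw
  ... | no w≢c   = cong φ (Fin.punchIn-punchOut w≢c)
  fibre : ∀ {c d} → Star (λ x y → Adj G x y × φ x ≡ φ y) c d →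
          Star (λ i j → Adj (contract G a w) i j × ψ i ≡ ψ j) (q c) (q d)
  fibre ε = ε
  fibre {c} (_◅_ {j = e} (ce , eq) s) with collapse-adj G aw ce
  ... | inj₁ qc≡qe = subst (λ i → Star _ i (q _)) (sym qc≡qe) (fibre s)
  ... | inj₂ adjᶜ  = (adjᶜ , trans (ψq c) (trans eq (sym (ψq e)))) ◅ fibre s
  loc : ∀ {i j} → Adj (contract G a w) i j → ψ i ≡ ψ j ⊎ PathAdj (ψ i) (ψ j)
  loc {i} {j} e with contract-adj⁻ G aw e
  ... | inj₁ ij = local P ij
  ... | inj₂ (inj₁ (i≡a , wj)) =
    subst (λ x → x ≡ ψ j ⊎ PathAdj x (ψ j)) (trans (sym φa≡φw) (cong φ (sym i≡a))) (local P wj)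
  ... | inj₂ (inj₂ (j≡a , wi)) =
    [ inj₁ ∘ sym , inj₂ ∘ PathAdj-sym {j = ψ i} ]′
      (subst (λ x → x ≡ ψ i ⊎ PathAdj x (ψ i)) (trans (sym φa≡φw) (cong φ (sym j≡a))) (local P wi))
  contracted : PathPartition (contract G a w) ψ
  contracted .onto j = let v , e = onto P j in q v , trans (ψq v) e
  contracted .fibres {i} {j} eq =
    subst₂ (Star _) (collapse-punchIn G aw i) (collapse-punchIn G aw j) (fibre (fibres P eq))
  contracted .local = loc
  contracted .linked {i} {j} p with linked P p
  ... | u , v , φu , φv , uv with collapse-adj G aw uv
  ...   | inj₂ e  = q u , q v , trans (ψq u) φu , trans (ψq v) φv , e
  ...   | inj₁ eq = contradiction (subst (PathAdj i) (sym i≡j) p) (PathAdj-irrefl {i = i})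
    where
    i≡j : i ≡ j
    i≡j = trans (sym φu) (trans (sym (ψq u)) (trans (cong ψ eq) (trans (ψq v) φv)))

-- Stars and split graphs

star-adj : ∀ {n} → Fin (suc n) → Fin (suc n) → Bool
star-adj zero    zero    = false
star-adj zero    (suc _) = true
star-adj (suc _) zero    = true
star-adj (suc _) (suc _) = false

star : ∀ n → Graph (suc n)
star n = record
  { adj     = star-adj
  ; adj-sym = λ where
      zero zero → refl
      zero (suc _) → refl
      (suc _) zero → refl
      (suc _) (suc _) → refl
  ; irrefl  = λ where
      zero → refl
      (suc _) → refl
  }

star-edge : ∀ {n} {u v : Fin (suc n)} → Adj (star n) u v → zero ≡ u ⊎ zero ≡ v
star-edge {u = zero}  {suc _} _ = inj₁ refl
star-edge {u = suc _} {zero}  _ = inj₂ refl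

-- Every edge contains the centre. A triangle has no vertex common to its three edges, and a longer
-- cycle has two disjoint edges, so injectivity fails.
star-isTree : ∀ n → IsTree (star n)
star-isTree n = (s≤s z≤n , connected) , acyclic
  where
  connected : ∀ u v → Star (Adj (star n)) u v
  connected zero    zero    = ε
  connected zero    (suc v) = _ ◅ ε
  connected (suc u) zero    = _ ◅ ε
  connected (suc u) (suc v) = _◅_ {j = zero} _ (_ ◅ ε)
  acyclic : ∀ ℓ .{{_ : NonZero ℓ}} (γ : Fin ℓ → Fin (suc n)) → ¬ IsCycle (star n) ℓ γ
  acyclic 3 γ (_ , inj , edge) = cases (e 0F 1F (inj₁ refl)) (e 1F 2F (inj₁ refl)) (e 2F 0F (inj₁ refl))
    where
    e : ∀ i j → CycleAdj 3 i j → zero ≡ γ i ⊎ zero ≡ γ j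
    e i j c = star-edge (edge i j c)
    cases : zero ≡ γ 0F ⊎ zero ≡ γ 1F → zero ≡ γ 1F ⊎ zero ≡ γ 2F → zero ≡ γ 2F ⊎ zero ≡ γ 0F → ⊥
    cases (inj₁ a) (inj₁ b) _        with () ← inj (trans (sym a) b)
    cases (inj₁ a) (inj₂ b) _        with () ← inj (trans (sym a) b)
    cases (inj₂ a) _        (inj₁ b) with () ← inj (trans (sym a) b)
    cases (inj₂ a) _        (inj₂ b) with () ← inj (trans (sym a) b)
  acyclic 1 γ (s≤s () , _)
  acyclic 2 γ (s≤s (s≤s ()) , _)
  acyclic ℓ@(suc (suc (suc (suc k)))) γ (_ , inj , edge) =
    cases (star-edge (edge 0F 1F (inj₁ (m<n⇒m%n≡m (s≤s (s≤s z≤n))))))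
          (star-edge (edge 2F 3F (inj₁ (m<n⇒m%n≡m (s≤s (s≤s (s≤s (s≤s z≤n))))))))
    where
    cases : zero ≡ γ 0F ⊎ zero ≡ γ 1F → zero ≡ γ 2F ⊎ zero ≡ γ 3F → ⊥
    cases (inj₁ a) (inj₁ b) with () ← inj (trans (sym a) b)
    cases (inj₁ a) (inj₂ b) with () ← inj (trans (sym a) b)
    cases (inj₂ a) (inj₁ b) with () ← inj (trans (sym a) b)
    cases (inj₂ a) (inj₂ b) with () ← inj (trans (sym a) b)

∣p∪q∣≤∣p∣+∣q∣ : ∀ {n} (p q : Subset n) → ∣ p ∪ q ∣ ≤ ∣ p ∣ + ∣ q ∣
∣p∪q∣≤∣p∣+∣q∣ []          []          = z≤n
∣p∪q∣≤∣p∣+∣q∣ (true  ∷ p) (true  ∷ q) =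
  s≤s (≤-trans (∣p∪q∣≤∣p∣+∣q∣ p q) (+-monoʳ-≤ ∣ p ∣ (n≤1+n _)))
∣p∪q∣≤∣p∣+∣q∣ (true  ∷ p) (false ∷ q) = s≤s (∣p∪q∣≤∣p∣+∣q∣ p q)
∣p∪q∣≤∣p∣+∣q∣ (false ∷ p) (true  ∷ q) =
  ≤-trans (s≤s (∣p∪q∣≤∣p∣+∣q∣ p q)) (≤-reflexive (sym (+-suc ∣ p ∣ _)))
∣p∪q∣≤∣p∣+∣q∣ (false ∷ p) (false ∷ q) = ∣p∪q∣≤∣p∣+∣q∣ p q

foldr-⊔-≤ : ∀ {A : Set} (f : A → ℕ) {k} → (∀ x → f x ≤ k) → ∀ xs → foldr _⊔_ 0 (map f xs) ≤ k
foldr-⊔-≤ f h []       = z≤n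
foldr-⊔-≤ f h (x ∷ xs) = ⊔-lub (h x) (foldr-⊔-≤ f h xs)

5%≢2 : ∀ k → 5 % (5 + k) ≢ 2
5%≢2 zero    ()
5%≢2 (suc k) e = contradiction (trans (sym (m<n⇒m%n≡m {m = 5} (m≤m+n 6 k))) e) λ ()

record SplitGraph {n} (G : Graph n) (C : Fin n → Bool) : Set where
  field
    clique : ∀ {u v} → T (C u) → T (C v) → u ≢ v → Adj G u v
    indep  : ∀ {u v} → ¬ T (C u) → ¬ T (C v) → ¬ Adj G u v

module _ {n} {G : Graph n} {C : Fin n → Bool} (split : SplitGraph G C) where
  open SplitGraph split

  split-edge : ∀ {u v} → Adj G u v → ¬ T (C u) → T (C v)
  split-edge {v = v} uv ¬Cu = decidable-stable (T? (C v)) (λ ¬Cv → indep ¬Cu ¬Cv uv)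

  -- On an induced cycle, consecutive vertices are not both outside the clique and nonconsecutive
  -- ones not both inside. Beyond length three this already fails on the first four or five
  -- vertices. Length four is separate because there 3 and 0 are consecutive.
  split-chordal : Chordal G
  split-chordal 1 γ ((s≤s () , _) , _)
  split-chordal 2 γ ((s≤s (s≤s ()) , _) , _)
  split-chordal 3 γ _ = refl
  split-chordal ℓ@4 γ ((_ , inj , edge) , induced) = ⊥-elim (cases (T? (C (γ 0F))))
    where
    next : ∀ i j → CycleAdj ℓ i j → ¬ T (C (γ i)) → T (C (γ j))
    next i j c = split-edge (edge i j c)
    far : ∀ i j → i ≢ j → T (C (γ i)) → T (C (γ j)) → CycleAdj ℓ i j
    far i j i≢j Ci Cj = induced i j (clique Ci Cj (i≢j ∘ inj))
    ¬02 : T (C (γ 0F)) → ¬ T (C (γ 2F))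
    ¬02 C₀ C₂ with far 0F 2F (λ ()) C₀ C₂
    ... | inj₁ ()
    ... | inj₂ ()
    ¬13 : T (C (γ 1F)) → ¬ T (C (γ 3F))
    ¬13 C₁ C₃ with far 1F 3F (λ ()) C₁ C₃
    ... | inj₁ ()
    ... | inj₂ ()
    cases : Dec (T (C (γ 0F))) → ⊥
    cases (yes C₀) = ¬13 (next 2F 1F (inj₂ refl) (¬02 C₀)) (next 2F 3F (inj₁ refl) (¬02 C₀))
    cases (no ¬C₀) = ¬13 (next 0F 1F (inj₁ refl) ¬C₀) (next 0F 3F (inj₂ refl) ¬C₀)
  split-chordal ℓ@(suc (suc (suc (suc (suc k))))) γ ((_ , inj , edge) , induced) =
    ⊥-elim (cases (T? (C (γ 0F))))
    where
    1% : 1 % ℓ ≡ 1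
    1% = m<n⇒m%n≡m (s≤s (s≤s z≤n))
    2% : 2 % ℓ ≡ 2
    2% = m<n⇒m%n≡m (s≤s (s≤s (s≤s z≤n)))
    3% : 3 % ℓ ≡ 3
    3% = m<n⇒m%n≡m (s≤s (s≤s (s≤s (s≤s z≤n))))
    4% : 4 % ℓ ≡ 4
    4% = m<n⇒m%n≡m (s≤s (s≤s (s≤s (s≤s (s≤s z≤n)))))
    next : ∀ i j → CycleAdj ℓ i j → ¬ T (C (γ i)) → T (C (γ j))
    next i j c = split-edge (edge i j c)
    far : ∀ i j → i ≢ j → T (C (γ i)) → T (C (γ j)) → CycleAdj ℓ i j
    far i j i≢j Ci Cj = induced i j (clique Ci Cj (i≢j ∘ inj))
    ¬02 : T (C (γ 0F)) → ¬ T (C (γ 2F))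
    ¬02 C₀ C₂ with far 0F 2F (λ ()) C₀ C₂
    ... | inj₁ e with () ← trans (sym 1%) e
    ... | inj₂ e with () ← trans (sym 3%) e
    ¬13 : T (C (γ 1F)) → ¬ T (C (γ 3F))
    ¬13 C₁ C₃ with far 1F 3F (λ ()) C₁ C₃
    ... | inj₁ e with () ← trans (sym 2%) e
    ... | inj₂ e with () ← trans (sym 4%) e
    ¬24 : T (C (γ 2F)) → ¬ T (C (γ 4F))
    ¬24 C₂ C₄ with far 2F 4F (λ ()) C₂ C₄
    ... | inj₁ e with () ← trans (sym 3%) e
    ... | inj₂ e = 5%≢2 k e
    cases : Dec (T (C (γ 0F))) → ⊥
    cases (yes C₀) = ¬13 (next 2F 1F (inj₂ 2%) (¬02 C₀)) (next 2F 3F (inj₁ 3%) (¬02 C₀))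
    cases (no ¬C₀) = ¬24 (next 3F 2F (inj₂ 3%) ¬C₃) (next 3F 4F (inj₁ 4%) ¬C₃)
      where
      ¬C₃ : ¬ T (C (γ 3F))
      ¬C₃ = ¬13 (next 0F 1F (inj₁ 1%) ¬C₀)

  split-connected : ∀ c → T (C c) → (∀ v → ¬ T (C v) → ∃[ c ] (T (C c) × Adj G v c)) → Connected G
  split-connected c₀ Cc₀ dominated =
    ≤-trans (s≤s z≤n) (Fin.toℕ<n c₀) , λ u v → proj₁ (spoke u) ◅◅ proj₂ (spoke v)
    where
    clique-spoke : ∀ {c} → T (C c) → Star (Adj G) c c₀ × Star (Adj G) c₀ c
    clique-spoke {c} Cc with c Fin.≟ c₀
    ... | yes refl = ε , ε
    ... | no c≢c₀  = let e = clique Cc Cc₀ c≢c₀ in (e ◅ ε) , (Adj-sym G e ◅ ε)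
    spoke : ∀ v → Star (Adj G) v c₀ × Star (Adj G) c₀ v
    spoke v with T? (C v)
    ... | yes Cv = clique-spoke Cv
    ... | no ¬Cv = let c , Cc , vc = dominated v ¬Cv
                       to-c₀ , from-c₀ = clique-spoke Cc
                   in (vc ◅ to-c₀) , (from-c₀ ◅◅ Adj-sym G vc ◅ ε)

  private
    K : Subset n
    K = Vec.tabulate C

    ∈K⁺ : ∀ {v} → T (C v) → v ∈ K
    ∈K⁺ {v} Cv with C v in eq
    ... | true = lookup⇒[]= v K (trans (lookup∘tabulate C v) eq)

    -- Clique vertices get a leaf too. Its bag is K again, and the leaves are then indexed by all
    -- vertices without renumbering.
    bags : Fin (suc n) → Subset n
    bags zero    = K
    bags (suc t) = K ∪ ⁅ t ⁆

    ∈K⇒∈bags : ∀ {v} t → v ∈ K → v ∈ bags t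
    ∈K⇒∈bags zero    v∈K = v∈K
    ∈K⇒∈bags (suc t) v∈K = x∈p∪q⁺ (inj₁ v∈K)

    ∈own : ∀ v → v ∈ bags (suc v)
    ∈own v = x∈p∪q⁺ (inj₂ (x∈⁅x⁆ v))

    ∈bags⁻ : ∀ {v} t → v ∈ bags t → v ∈ K ⊎ suc v ≡ t
    ∈bags⁻ zero    v∈ = inj₁ v∈
    ∈bags⁻ (suc t) v∈ = [ inj₁ , inj₂ ∘ cong suc ∘ x∈⁅y⁆⇒x≡y t ]′ (x∈p∪q⁻ K ⁅ t ⁆ v∈)

    edge-bag : ∀ {u v} → Adj G u v → ∃[ t ] (u ∈ bags t × v ∈ bags t)
    edge-bag {u} {v} uv with T? (C u)
    ... | yes Cu = suc v , ∈K⇒∈bags (suc v) (∈K⁺ Cu) , ∈own v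
    ... | no ¬Cu = suc u , ∈own u , ∈K⇒∈bags (suc u) (∈K⁺ (split-edge uv ¬Cu))

    everywhere : ∀ {v} → v ∈ K → ∀ s t →
                 Star (λ a b → Adj (star n) a b × v ∈ bags a × v ∈ bags b) s t
    everywhere v∈K s t =
      Star.map (λ {a} {b} e → e , ∈K⇒∈bags a v∈K , ∈K⇒∈bags b v∈K)
               (proj₂ (proj₁ (star-isTree n)) s t)

    link : ∀ v {s t} → v ∈ bags s → v ∈ bags t →
           Star (λ a b → Adj (star n) a b × v ∈ bags a × v ∈ bags b) s t
    link v {s} {t} v∈s v∈t with ∈bags⁻ s v∈s | ∈bags⁻ t v∈t
    ... | inj₂ refl | inj₂ refl = ε
    ... | inj₁ v∈K  | _         = everywhere v∈K s t
    ... | inj₂ _    | inj₁ v∈K  = everywhere v∈K s t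

    bag-size : ∀ t → ∣ bags t ∣ ≤ 1 + ∣ K ∣
    bag-size zero    = n≤1+n _
    bag-size (suc t) = ≤-trans (∣p∪q∣≤∣p∣+∣q∣ K ⁅ t ⁆)
      (≤-reflexive (trans (cong (∣ K ∣ +_) (∣⁅x⁆∣≡1 t)) (+-comm ∣ K ∣ 1)))

  split-decomposition : TreeDecomposition G
  split-decomposition = record
    { nodes = suc n ; tree = star n ; isTree = star-isTree n ; bag = bags
    ; covers-V = λ v → suc v , ∈own v ; covers-E = edge-bag ; connected = link }

  split-width : TreeDecomposition.width split-decomposition ≤ ∣ Vec.tabulate C ∣
  split-width = ∸-monoˡ-≤ 1 (foldr-⊔-≤ (∣_∣ ∘ bags) bag-size (allFin (suc n)))

  -- Every vertex is at distance at most two from every clique vertex, so no clique vertex is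
  -- mapped to an end of a path on four or more vertices.
  long-path⇒far-pair : (∀ v → ¬ T (C v) → ∃[ c ] (T (C c) × Adj G v c)) →
    ∀ {m} (f : Fin n → Fin (4 + m)) → (∀ j → ∃[ v ] f v ≡ j) →
    (∀ {u v} → Adj G u v → f u ≡ f v ⊎ PathAdj (f u) (f v)) →
    ∃[ u ] ∃[ v ] (¬ T (C u) × ¬ T (C v) × ∀ c → Adj G u c → ¬ Adj G v c)
  long-path⇒far-pair dominated {m} f onto local =
    let x , fx = onto zero
        y , fy = onto (Fin.fromℕ (3 + m))
        px = cong toℕ fx
        py = trans (cong toℕ fy) (Fin.toℕ-fromℕ (3 + m))
    in x , y , (λ Cx → ends x y Cx px py) , (λ Cy → ends′ x y Cy px py) ,
       -- A common neighbour of the ends would have position at most 1 and at least 2.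
       λ _ xc yc → 1+n≰n (≤-trans (s≤s (s≤s (≤-trans (near xc) (≤-reflexive (cong suc px)))))
                          (≤-trans (m≤m+n 3 m) (≤-trans (≤-reflexive (sym py)) (near′ yc))))
    where
    pos : Fin n → ℕ
    pos v = toℕ (f v)
    near′ : ∀ {u v} → Adj G u v → pos u ≤ suc (pos v)
    near′ uv with local uv
    ... | inj₁ eq        = ≤-trans (≤-reflexive (cong toℕ eq)) (n≤1+n _)
    ... | inj₂ (inj₁ eq) = ≤-trans (n≤1+n _) (≤-trans (≤-reflexive eq) (n≤1+n _))
    ... | inj₂ (inj₂ eq) = ≤-reflexive (sym eq)
    near : ∀ {u v} → Adj G u v → pos v ≤ suc (pos u)
    near uv = near′ (Adj-sym G uv)
    -- The witness w is the middle of a walk of length at most two from v to c.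
    within : ∀ {c} v → T (C c) → ∃[ w ] (pos v ≤ suc (pos w) × pos w ≤ suc (pos v) ×
                                         pos w ≤ suc (pos c) × pos c ≤ suc (pos w))
    within {c} v Cc with T? (C v) | c Fin.≟ v
    ... | _      | yes refl = v , n≤1+n _ , n≤1+n _ , n≤1+n _ , n≤1+n _
    ... | yes Cv | no c≢v = v , n≤1+n _ , n≤1+n _ , near (clique Cc Cv c≢v) , near′ (clique Cc Cv c≢v)
    ... | no ¬Cv | _ with dominated v ¬Cv
    ...   | w , Cw , vw with c Fin.≟ w
    ...     | yes refl = w , near′ vw , near vw , n≤1+n _ , n≤1+n _
    ...     | no c≢w   = w , near′ vw , near vw , near (clique Cc Cw c≢w) , near′ (clique Cc Cw c≢w)
    ends : ∀ x y → T (C x) → pos x ≡ 0 → pos y ≡ 3 + m → ⊥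
    ends x y Cx px py with within y Cx
    ... | w , yw , _ , wx , _ rewrite px | py = 1+n≰n (≤-trans (≤-trans (m≤m+n 2 m) (s≤s⁻¹ yw)) wx)
    ends′ : ∀ x y → T (C y) → pos x ≡ 0 → pos y ≡ 3 + m → ⊥
    ends′ x y Cy px py with within x Cy
    ... | w , _ , wx , _ , yw rewrite px | py = 1+n≰n (≤-trans (≤-trans (m≤m+n 2 m) (s≤s⁻¹ yw)) wx)

  module _ {x y a b : Fin n}
    (¬Cx : ¬ T (C x)) (¬Cy : ¬ T (C y)) (Ca : T (C a)) (Cb : T (C b))
    (xa : Adj G x a) (yb : Adj G y b) (far : ∀ c → Adj G x c → ¬ Adj G y c)
    (cover : ∀ v → ¬ T (C v) → Adj G v a ⊎ Adj G v b) where

    private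
      -- Clique vertices are divided by adjacency to y; by `far`, the neighbours of x then all land
      -- at 1 and those of y at 2. Independent vertices go to a side whose centre they are adjacent
      -- to, which keeps the parts connected.
      inner : Fin n → Fin 4
      inner v = if C v then (if adj G y v then 2F else 1F) else (if adj G v a then 1F else 2F)

      position : Fin n → Fin 4
      position v with v Fin.≟ x | v Fin.≟ y
      ... | yes _ | _     = 0F
      ... | no _  | yes _ = 3F
      ... | no _  | no _  = inner v

      centre : Fin 4 → Fin n
      centre 0F = x
      centre 1F = a
      centre 2F = b
      centre 3F = y

      x≢y : x ≢ y
      x≢y refl = far a xa (subst (λ v → Adj G v a) refl xa)

      C⇒≢x : ∀ {v} → T (C v) → v ≢ x
      C⇒≢x Cv refl = ¬Cx Cv

      C⇒≢y : ∀ {v} → T (C v) → v ≢ y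
      C⇒≢y Cv refl = ¬Cy Cv

      position-x : position x ≡ 0F
      position-x with x Fin.≟ x
      ... | yes _  = refl
      ... | no x≢x = contradiction refl x≢x

      position-y : position y ≡ 3F
      position-y with y Fin.≟ x | y Fin.≟ y
      ... | yes y≡x | _      = contradiction (sym y≡x) x≢y
      ... | no _    | yes _  = refl
      ... | no _    | no y≢y = contradiction refl y≢y

      position-inner : ∀ {v} → v ≢ x → v ≢ y → position v ≡ inner v
      position-inner {v} v≢x v≢y with v Fin.≟ x | v Fin.≟ y
      ... | yes v≡x | _       = contradiction v≡x v≢x
      ... | no _    | yes v≡y = contradiction v≡y v≢y
      ... | no _    | no _    = refl

      inner-C-1 : ∀ {v} → T (C v) → ¬ Adj G y v → inner v ≡ 1F
      inner-C-1 {v} Cv ¬yv with C v | adj G y v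
      ... | true | true  = contradiction _ ¬yv
      ... | true | false = refl

      inner-C-2 : ∀ {v} → T (C v) → Adj G y v → inner v ≡ 2F
      inner-C-2 {v} Cv yv with C v | adj G y v
      ... | true | true = refl

      near-x : ∀ {v} → Adj G x v → position v ≡ 1F
      near-x {v} xv = let Cv = split-edge xv ¬Cx in
        trans (position-inner (C⇒≢x Cv) (C⇒≢y Cv)) (inner-C-1 Cv (far v xv))

      near-y : ∀ {v} → Adj G y v → position v ≡ 2F
      near-y {v} yv = let Cv = split-edge yv ¬Cy in
        trans (position-inner (C⇒≢x Cv) (C⇒≢y Cv)) (inner-C-2 Cv yv)

      inner-centre : ∀ v → v ≡ centre (inner v) ⊎ Adj G v (centre (inner v))
      inner-centre v with C v in Cv≡ | adj G y v in yv≡ | adj G v a in va≡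
      ... | true | true | _ with v Fin.≟ b
      ...   | yes v≡b = inj₁ v≡b
      ...   | no v≢b  = inj₂ (clique (subst T (sym Cv≡) _) Cb v≢b)
      inner-centre v | true | false | _ with v Fin.≟ a
      ...   | yes v≡a = inj₁ v≡a
      ...   | no v≢a  = inj₂ (clique (subst T (sym Cv≡) _) Ca v≢a)
      inner-centre v | false | _ | true = inj₂ (subst T (sym va≡) _)
      inner-centre v | false | _ | false =
        [ (λ va → ⊥-elim (subst T va≡ va)) , inj₂ ]′ (cover v (subst T Cv≡))

      to-centre : ∀ v → v ≡ centre (position v) ⊎ Adj G v (centre (position v))
      to-centre v with v Fin.≟ x | v Fin.≟ y
      ... | yes v≡x | _       = inj₁ v≡x
      ... | no _    | yes v≡y = inj₁ v≡y
      ... | no _    | no _    = inner-centre v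

      position-centre : ∀ j → position (centre j) ≡ j
      position-centre 0F = position-x
      position-centre 1F = near-x xa
      position-centre 2F = near-y yb
      position-centre 3F = position-y

      a≢b : a ≢ b
      a≢b refl = far a xa yb

      linked′ : ∀ i j → suc (toℕ i) ≡ toℕ j → Adj G (centre i) (centre j)
      linked′ 0F 1F _ = xa
      linked′ 1F 2F _ = clique Ca Cb a≢b
      linked′ 2F 3F _ = Adj-sym G yb
      linked′ 1F 1F ()
      linked′ 2F 2F ()
      linked′ 3F 3F ()

      InFibre : Fin n → Fin n → Set
      InFibre u v = Adj G u v × position u ≡ position v

      spoke : ∀ v → Star InFibre v (centre (position v)) × Star InFibre (centre (position v)) v
      spoke v with to-centre v
      ... | inj₁ eq = subst (λ c → Star InFibre v c × Star InFibre c v) eq (ε , ε)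
      ... | inj₂ vc = ((vc , sym (position-centre _)) ◅ ε) ,
                      ((Adj-sym G vc , position-centre _) ◅ ε)

      middle : ∀ {v} → v ≢ x → v ≢ y → position v ≡ 1F ⊎ position v ≡ 2F
      middle {v} v≢x v≢y rewrite position-inner v≢x v≢y with C v | adj G y v | adj G v a
      ... | true  | true  | _     = inj₂ refl
      ... | true  | false | _     = inj₁ refl
      ... | false | _     | true  = inj₁ refl
      ... | false | _     | false = inj₂ refl

      Near : Fin 4 → Fin 4 → Set
      Near i j = i ≡ j ⊎ PathAdj i j

      -- Positions 1 and 2 tolerate any edge between them, so only edges at x or y need an argument,
      -- given by `near-x` and `near-y`.
      loc : ∀ {u v} → Adj G u v → Near (position u) (position v)
      loc {u} {v} uv = by (u Fin.≟ x) (v Fin.≟ x) (u Fin.≟ y) (v Fin.≟ y)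
        where
        near : ∀ {i j} → position u ≡ i → position v ≡ j → Near i j → Near (position u) (position v)
        near refl refl h = h
        by : Dec (u ≡ x) → Dec (v ≡ x) → Dec (u ≡ y) → Dec (v ≡ y) → Near (position u) (position v)
        by (yes refl) _ _ _ = near position-x (near-x uv) (inj₂ (inj₁ refl))
        by _ (yes refl) _ _ = near (near-x (Adj-sym G uv)) position-x (inj₂ (inj₂ refl))
        by _ _ (yes refl) _ = near position-y (near-y uv) (inj₂ (inj₂ refl))
        by _ _ _ (yes refl) = near (near-y (Adj-sym G uv)) position-y (inj₂ (inj₁ refl))
        by (no u≢x) (no v≢x) (no u≢y) (no v≢y) with middle u≢x u≢y | middle v≢x v≢y
        ... | inj₁ p | inj₁ q = near p q (inj₁ refl)
        ... | inj₁ p | inj₂ q = near p q (inj₂ (inj₁ refl))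
        ... | inj₂ p | inj₁ q = near p q (inj₂ (inj₂ refl))
        ... | inj₂ p | inj₂ q = near p q (inj₁ refl)

    four-path : Σ (Fin n → Fin 4) (PathPartition G)
    four-path .proj₁ = position
    four-path .proj₂ .onto j = centre j , position-centre j
    four-path .proj₂ .fibres {u} {v} eq =
      proj₁ (spoke u) ◅◅ subst (λ j → Star InFibre (centre j) v) (sym eq) (proj₂ (spoke v))
    four-path .proj₂ .local = loc
    four-path .proj₂ .linked {i} {j} (inj₁ p) =
      centre i , centre j , position-centre i , position-centre j , linked′ i j p
    four-path .proj₂ .linked {i} {j} (inj₂ p) =
      centre i , centre j , position-centre i , position-centre j , Adj-sym G (linked′ j i p)

-- The constructed graph and its encoding

nonzero : ℕ → Bool
nonzero zero    = false
nonzero (suc _) = true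

nonzero-bit : ∀ b → nonzero (bit b) ≡ b
nonzero-bit true  = refl
nonzero-bit false = refl

tabulate≡applyUpTo : ∀ {A : Set} {n} {f : Fin n → A} {g : ℕ → A} →
                     (∀ i → f i ≡ g (toℕ i)) → tabulate f ≡ applyUpTo g n
tabulate≡applyUpTo {n = zero}  h = refl
tabulate≡applyUpTo {n = suc n} h = cong₂ _∷_ (h zero) (tabulate≡applyUpTo (h ∘ suc))

map-allFin : ∀ {A : Set} {n} {f : Fin n → A} {g : ℕ → A} →
             (∀ i → f i ≡ g (toℕ i)) → map f (allFin n) ≡ applyUpTo g n
map-allFin {f = f} h = trans (map-tabulate id f) (tabulate≡applyUpTo h)

map-toℕ-filter : ∀ {n} (p : ℕ → Bool) (vs : List (Fin n)) →
  map toℕ (filter (λ u → T? (p (toℕ u))) vs) ≡ filter (λ u → T? (p u)) (map toℕ vs)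
map-toℕ-filter p []       = refl
map-toℕ-filter p (v ∷ vs) with p (toℕ v)
... | true  = cong (toℕ v ∷_) (map-toℕ-filter p vs)
... | false = map-toℕ-filter p vs

filter-upTo-suc : ∀ (p : ℕ → Bool) n →
  filter (λ u → T? (p u)) (upTo (suc n)) ≡
  (if p n then filter (λ u → T? (p u)) (upTo n) ∷ʳ n else filter (λ u → T? (p u)) (upTo n))
filter-upTo-suc p n =
  trans (cong (filter P?) (sym (applyUpTo-∷ʳ id n))) (trans (filter-++ P? (upTo n) (n ∷ [])) last)
  where
  P? = λ u → T? (p u)
  last : filter P? (upTo n) ++ filter P? (n ∷ []) ≡
         (if p n then filter P? (upTo n) ∷ʳ n else filter P? (upTo n))
  last with p n
  ... | true  = refl
  ... | false = ++-identityʳ _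

scanl-∷ʳ : ∀ e xs x → scanl _+_ e (xs ∷ʳ x) ≡ scanl _+_ e xs ∷ʳ (foldl _+_ e xs + x)
scanl-∷ʳ e []       x = refl
scanl-∷ʳ e (y ∷ xs) x = cong (e ∷_) (scanl-∷ʳ (e + y) xs x)

∣tabulate-<∣ : ∀ n k → ∣ Vec.tabulate {n = n} (λ v → toℕ v <ᵇ k) ∣ ≤ k
∣tabulate-<∣ zero    k       = z≤n
∣tabulate-<∣ (suc n) zero    = ∣tabulate-<∣ n zero
∣tabulate-<∣ (suc n) (suc k) = s≤s (∣tabulate-<∣ n k)

module Reduction (as : List ℕ) (n d : ℕ) where

  open Construction as n d public
  open Transformation as n d public

  high-≥ : ∀ {v u} → u ≤ v → high v u ≡ v
  high-≥ {v} u≤v rewrite m≤n⇒m∸n≡0 u≤v = +-identityʳ v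

  high-≤ : ∀ {v u} → v ≤ u → high v u ≡ u
  high-≤ v≤u = m+[n∸m]≡n v≤u

  low-≥ : ∀ {v u} → u ≤ v → low v u ≡ u
  low-≥ u≤v rewrite m≤n⇒m∸n≡0 u≤v = refl

  low-≤ : ∀ {v u} → v ≤ u → low v u ≡ v
  low-≤ v≤u = m∸[m∸n]≡n v≤u

  -- The first conjunct discards the meaningless flags between two rows; within the range scanned by
  -- the program it is always true.
  adjacent : ℕ → ℕ → Bool
  adjacent v u = (low v u <ᵇ D) ∧ nonzero (flag v u)

  adjacent-sym : ∀ v u → adjacent v u ≡ adjacent u v
  adjacent-sym v u with ≤-total u v
  ... | inj₁ u≤v rewrite high-≥ u≤v | low-≥ u≤v | high-≤ u≤v | low-≤ u≤v = refl
  ... | inj₂ v≤u rewrite high-≤ v≤u | low-≤ v≤u | high-≥ v≤u | low-≥ v≤u = refl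

  adjacent-clique : ∀ {v u} → v < D → u < D → v ≢ u → T (adjacent v u)
  adjacent-clique {v} {u} v<D u<D v≢u with <-cmp v u
  ... | tri≈ _ v≡u _ = contradiction v≡u v≢u
  ... | tri< v<u _ _
    rewrite high-≤ (<⇒≤ v<u) | low-≤ (<⇒≤ v<u) | <ᵇ-true v<D | <ᵇ-true u<D | <ᵇ-true v<u = _
  ... | tri> _ _ u<v
    rewrite high-≥ (<⇒≤ u<v) | low-≥ (<⇒≤ u<v) | <ᵇ-true v<D | <ᵇ-true u<D | <ᵇ-true u<v = _

  adjacent-indep : ∀ {v u} → D ≤ v → D ≤ u → adjacent v u ≡ false
  adjacent-indep {v} {u} D≤v D≤u with ≤-total u v
  ... | inj₁ u≤v rewrite low-≥ u≤v | <ᵇ-false D≤u = refl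
  ... | inj₂ v≤u rewrite low-≤ v≤u | <ᵇ-false D≤v = refl

  adjacent-cross : ∀ {v c} → D ≤ v → c < D → adjacent v c ≡ nonzero (inc (v ∸ D) c)
  adjacent-cross D≤v c<D
    rewrite high-≥ (<⇒≤ (<-≤-trans c<D D≤v)) | low-≥ (<⇒≤ (<-≤-trans c<D D≤v)) | <ᵇ-true c<D | <ᵇ-false D≤v
    = refl

  adjacent-irrefl : ∀ v → adjacent v v ≡ false
  adjacent-irrefl v with <-≤-connex v D
  ... | inj₁ v<D rewrite high-≥ (≤-refl {v}) | low-≥ (≤-refl {v}) | <ᵇ-true v<D | <ᵇ-false (≤-refl {v}) = refl
  ... | inj₂ D≤v = adjacent-indep D≤v D≤v

  G : Graph N
  G = record
    { adj     = λ u v → adjacent (toℕ u) (toℕ v)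
    ; adj-sym = λ u v → adjacent-sym (toℕ u) (toℕ v)
    ; irrefl  = λ v → adjacent-irrefl (toℕ v)
    }

  column : Fin N → Bool
  column v = toℕ v <ᵇ D

  column⁻ : ∀ {v} → T (column v) → toℕ v < D
  column⁻ = <ᵇ⇒< _ D

  row⁺ : ∀ {v} → D ≤ toℕ v → ¬ T (column v)
  row⁺ D≤v Cv = ≤⇒≯ D≤v (<ᵇ⇒< _ D Cv)

  row⁻ : ∀ {v} → ¬ T (column v) → D ≤ toℕ v
  row⁻ ¬Cv = ≮⇒≥ (¬Cv ∘ <⇒<ᵇ)

  G-split : SplitGraph G column
  G-split = record
    { clique = λ {u} {v} Cu Cv u≢v → adjacent-clique (column⁻ {u} Cu) (column⁻ {v} Cv) (u≢v ∘ Fin.toℕ-injective)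
    ; indep  = λ {u} {v} ¬Cu ¬Cv → subst T (adjacent-indep (row⁻ {u} ¬Cu) (row⁻ {v} ¬Cv))
    }

  D≤N : D ≤ N
  D≤N = m≤n+m D (n + n)

  col : ∀ c → c < D → Fin N
  col c c<D = fromℕ< (<-≤-trans c<D D≤N)

  toℕ-col : ∀ c (c<D : c < D) → toℕ (col c c<D) ≡ c
  toℕ-col c c<D = Fin.toℕ-fromℕ< _

  col-column : ∀ c (c<D : c < D) → T (column (col c c<D))
  col-column c c<D rewrite toℕ-col c c<D = <⇒<ᵇ c<D

  incident : ∀ {v c} → D ≤ toℕ v → (c<D : c < D) → adj G v (col c c<D) ≡ nonzero (inc (toℕ v ∸ D) c)
  incident {v} {c} D≤v c<D rewrite toℕ-col c c<D = adjacent-cross D≤v c<D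

  c₀ c₁ : Fin N
  c₀ = col 0 (s≤s z≤n)
  c₁ = col 1 (s≤s (s≤s z≤n))

  row-c₀ : ∀ {v} → D ≤ toℕ v → adj G v c₀ ≡ (toℕ v ∸ D <ᵇ n)
  row-c₀ {v} D≤v = trans (incident {v} D≤v (s≤s z≤n)) (nonzero-bit _)

  row-c₁ : ∀ {v} → D ≤ toℕ v → adj G v c₁ ≡ not (toℕ v ∸ D <ᵇ n)
  row-c₁ {v} D≤v = trans (incident {v} D≤v (s≤s (s≤s z≤n))) (lemma (toℕ v ∸ D <ᵇ n))
    where
    lemma : ∀ b → nonzero (1 ∸ bit b) ≡ not b
    lemma true  = refl
    lemma false = refl

  row-cover : ∀ v → ¬ T (column v) → Adj G v c₀ ⊎ Adj G v c₁
  row-cover v ¬Cv =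
    subst₂ (λ a b → T a ⊎ T b) (sym (row-c₀ {v} D≤v)) (sym (row-c₁ {v} D≤v)) (lemma (toℕ v ∸ D <ᵇ n))
    where
    D≤v = row⁻ {v} ¬Cv
    lemma : ∀ b → T b ⊎ T (not b)
    lemma true  = inj₁ _
    lemma false = inj₂ _

  column-c₀ : T (column c₀)
  column-c₀ = col-column 0 (s≤s z≤n)

  column-c₁ : T (column c₁)
  column-c₁ = col-column 1 (s≤s (s≤s z≤n))

  row-dominated : ∀ v → ¬ T (column v) → ∃[ c ] (T (column c) × Adj G v c)
  row-dominated v ¬Cv = [ (λ e → c₀ , column-c₀ , e) , (λ e → c₁ , column-c₁ , e) ]′ (row-cover v ¬Cv)

  G-chordal : Chordal G
  G-chordal = split-chordal G-split

  G-connected : Connected G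
  G-connected = split-connected G-split c₀ column-c₀ row-dominated

  -- This and the next functions are closed forms for what the two passes accumulate, the link
  -- between the program and `encodeGraph`.
  nbs : ℕ → ℕ → List ℕ
  nbs v zero    = []
  nbs v (suc u) = choose (flag v u) (_∷ʳ u) (nbs v u)

  nb : ℕ → List ℕ
  nb v = nbs v (bound v)

  cat : ℕ → List ℕ
  cat zero    = []
  cat (suc v) = cat v ++ nb v

  total : ℕ → ℕ
  total zero    = 0
  total (suc v) = total v + length (nb v)

  offsets : ℕ → List ℕ
  offsets zero    = []
  offsets (suc v) = offsets v ∷ʳ total (suc v)

  count-inner : ∀ v u {s out} → Offsets.inner v u (s , out) ≡ (s + length (nbs v u) , out)
  count-inner v zero = cong (_, _) (sym (+-identityʳ _))
  count-inner v (suc u) {s} {out} rewrite count-inner v u {s} {out} with flag v u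
  ... | zero  = refl
  ... | suc _ = cong (_, out) (trans (sym (+-suc s _)) (cong (s +_) (sym (length-∷ʳ (nbs v u) u))))

  emit-inner : ∀ v u {s out} → Edges.inner v u (s , out) ≡ (s , out ++ nbs v u)
  emit-inner v zero = cong (_ ,_) (sym (++-identityʳ _))
  emit-inner v (suc u) {s} {out} rewrite emit-inner v u {s} {out} with flag v u
  ... | zero  = refl
  ... | suc _ = cong (s ,_) (++-assoc out (nbs v u) (u ∷ []))

  count-outer : ∀ v {out} → Offsets.outer v (0 , out) ≡ (total v , out ++ offsets v)
  count-outer zero = cong (0 ,_) (sym (++-identityʳ _))
  count-outer (suc v) {out}
    rewrite count-outer v {out} | count-inner v (bound v) {total v} {out ++ offsets v}
    = cong (total (suc v) ,_) (++-assoc out (offsets v) _)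

  emit-outer : ∀ v {s out} → Edges.outer v (s , out) ≡ (s , out ++ cat v)
  emit-outer zero = cong (_ ,_) (sym (++-identityʳ _))
  emit-outer (suc v) {s} {out} rewrite emit-outer v {s} {out} | emit-inner v (bound v) {s} {out ++ cat v}
    = cong (s ,_) (++-assoc out (cat v) _)

  output≡ : output ≡ N ∷ (N ∸ 4) ∷ (0 ∷ offsets N) ++ cat N
  output≡ = trans (cong (λ acc → proj₂ (Edges.outer N acc)) (count-outer N))
                  (cong proj₂ (emit-outer N))

  private
    sel : ℕ → ℕ → List ℕ
    sel v u = filter (λ w → T? (adjacent v w)) (upTo u)

  u<bound⇒low<D : ∀ {v u} → u < bound v → low v u < D
  u<bound⇒low<D {v} {u} u<b with v <ᵇ D in e
  ... | true  = ≤-<-trans (low≤ˡ v u) (<ᵇ⇒< v D (subst T (sym e) _))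
  ... | false = ≤-<-trans (low≤ʳ v u) u<b

  sel-below : ∀ v u → u ≤ bound v → sel v u ≡ nbs v u
  sel-below v zero    _   = refl
  sel-below v (suc u) u<b = trans (filter-upTo-suc (adjacent v) u) last
    where
    last : (if adjacent v u then sel v u ∷ʳ u else sel v u) ≡ nbs v (suc u)
    last rewrite sel-below v u (<⇒≤ u<b) | <ᵇ-true (u<bound⇒low<D {v} {u} u<b) with flag v u
    ... | zero  = refl
    ... | suc _ = refl

  -- Stopping the scan early loses no neighbour: for a column nothing lies beyond N, and for a row
  -- everything from D on is a row as well.
  adjacent-beyond : ∀ v k → bound v + k < N → adjacent v (bound v + k) ≡ false
  adjacent-beyond v k lt with v <ᵇ D in e
  ... | true  = contradiction (≤-trans (s≤s (m≤m+n N k)) lt) 1+n≰n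
  ... | false = adjacent-indep {v} (≮⇒≥ (subst T e ∘ <⇒<ᵇ)) (m≤m+n D k)

  sel-above : ∀ v k → bound v + k ≤ N → sel v (bound v + k) ≡ nb v
  sel-above v zero    _ rewrite +-identityʳ (bound v) = sel-below v (bound v) ≤-refl
  sel-above v (suc k) le = trans (cong (sel v) (+-suc (bound v) k))
    (trans (filter-upTo-suc (adjacent v) (bound v + k)) last)
    where
    lt : bound v + k < N
    lt = subst (_≤ N) (+-suc (bound v) k) le
    last : (if adjacent v (bound v + k) then sel v (bound v + k) ∷ʳ (bound v + k)
            else sel v (bound v + k)) ≡ nb v
    last rewrite adjacent-beyond v k lt = sel-above v k (<⇒≤ lt)

  neighbours≡ : ∀ v → map toℕ (neighbours G v) ≡ nb (toℕ v)
  neighbours≡ v = begin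
    map toℕ (neighbours G v)
      ≡⟨ map-toℕ-filter (adjacent (toℕ v)) (allFin N) ⟩
    filter (λ w → T? (adjacent (toℕ v) w)) (map toℕ (allFin N))
      ≡⟨ cong (filter (λ w → T? (adjacent (toℕ v) w))) (map-allFin {n = N} {f = toℕ} {g = id} (λ _ → refl)) ⟩
    sel (toℕ v) N
      ≡⟨ cong (sel (toℕ v)) (m+[n∸m]≡n (bound≤N (toℕ v))) ⟨
    sel (toℕ v) (bound (toℕ v) + (N ∸ bound (toℕ v)))
      ≡⟨ sel-above (toℕ v) _ (≤-reflexive (m+[n∸m]≡n (bound≤N (toℕ v)))) ⟩
    nb (toℕ v) ∎
    where open ≡-Reasoning

  concat-nb : ∀ v → concat (applyUpTo nb v) ≡ cat v
  concat-nb zero = refl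
  concat-nb (suc v) = begin
    concat (applyUpTo nb (suc v))                    ≡⟨ cong concat (applyUpTo-∷ʳ nb v) ⟨
    concat (applyUpTo nb v ∷ʳ nb v)                  ≡⟨ concat-++ (applyUpTo nb v) (nb v ∷ []) ⟨
    concat (applyUpTo nb v) ++ concat (nb v ∷ [])    ≡⟨ cong₂ _++_ (concat-nb v) (++-identityʳ (nb v)) ⟩
    cat (suc v)                                      ∎
    where open ≡-Reasoning

  foldl-nb : ∀ v → foldl _+_ 0 (applyUpTo (length ∘ nb) v) ≡ total v
  foldl-nb zero = refl
  foldl-nb (suc v) = begin
    foldl _+_ 0 (applyUpTo (length ∘ nb) (suc v))         ≡⟨ cong (foldl _+_ 0) (applyUpTo-∷ʳ (length ∘ nb) v) ⟨
    foldl _+_ 0 (applyUpTo (length ∘ nb) v ∷ʳ length (nb v)) ≡⟨ foldl-∷ʳ _+_ 0 _ (applyUpTo (length ∘ nb) v) ⟩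
    foldl _+_ 0 (applyUpTo (length ∘ nb) v) + length (nb v)  ≡⟨ cong (_+ length (nb v)) (foldl-nb v) ⟩
    total (suc v)                                          ∎
    where open ≡-Reasoning

  scanl-nb : ∀ v → scanl _+_ 0 (applyUpTo (length ∘ nb) v) ≡ 0 ∷ offsets v
  scanl-nb zero = refl
  scanl-nb (suc v) = begin
    scanl _+_ 0 (applyUpTo (length ∘ nb) (suc v))
      ≡⟨ cong (scanl _+_ 0) (applyUpTo-∷ʳ (length ∘ nb) v) ⟨
    scanl _+_ 0 (applyUpTo (length ∘ nb) v ∷ʳ length (nb v))
      ≡⟨ scanl-∷ʳ 0 (applyUpTo (length ∘ nb) v) _ ⟩
    scanl _+_ 0 (applyUpTo (length ∘ nb) v) ∷ʳ (foldl _+_ 0 (applyUpTo (length ∘ nb) v) + length (nb v))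
      ≡⟨ cong₂ (λ xs t → xs ∷ʳ (t + length (nb v))) (scanl-nb v) (foldl-nb v) ⟩
    0 ∷ offsets (suc v) ∎
    where open ≡-Reasoning

  output≡encoding : output ≡ N ∷ (N ∸ 4) ∷ encodeGraph G
  output≡encoding = trans output≡ (cong (λ xs → N ∷ (N ∸ 4) ∷ xs) (sym (cong₂ _++_
    (trans (cong (scanl _+_ 0) (map-allFin lengths)) (scanl-nb N))
    (trans (cong concat (map-allFin neighbours≡)) (concat-nb N)))))
    where
    lengths : ∀ v → length (neighbours G v) ≡ length (nb (toℕ v))
    lengths v = trans (sym (length-map toℕ (neighbours G v))) (cong length (neighbours≡ v))

-- Orthogonal pairs and contractions of the constructed graph

Orthogonal : ∀ {d} → Vec Bool d → Vec Bool d → Set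
Orthogonal x y = ∀ k → T (lookup x k) → ¬ T (lookup y k)

orthogonal⁺ : ∀ {d} (x y : Vec Bool d) → ⟨ x ∙ y ⟩ ≡ 0 → Orthogonal x y
orthogonal⁺ (true  ∷ x) (true  ∷ y) ()  zero
orthogonal⁺ (true  ∷ x) (false ∷ y) eq zero    _  = id
orthogonal⁺ (false ∷ x) (_ ∷ y)     eq zero    ()
orthogonal⁺ (a ∷ x)     (b ∷ y)     eq (suc k) = orthogonal⁺ x y (m+n≡0⇒n≡0 (bit a * bit b) eq) k

orthogonal⁻ : ∀ {d} (x y : Vec Bool d) → Orthogonal x y → ⟨ x ∙ y ⟩ ≡ 0
orthogonal⁻ []          []          _ = refl
orthogonal⁻ (true  ∷ x) (true  ∷ y) h = contradiction _ (h zero _)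
orthogonal⁻ (true  ∷ x) (false ∷ y) h = orthogonal⁻ x y (h ∘ suc)
orthogonal⁻ (false ∷ x) (_ ∷ y)     h = orthogonal⁻ x y (h ∘ suc)

cell-row : ∀ {d} (x : Vec Bool d) rest k →
           cell (map bit (toList x) ++ rest) (toℕ k) ≡ bit (lookup x k)
cell-row (a ∷ x) rest zero    = refl
cell-row (a ∷ x) rest (suc k) = cell-row x rest k

length-row : ∀ {d} (x : Vec Bool d) → length (map bit (toList x)) ≡ d
length-row x = trans (length-map bit (toList x)) (length-toList x)

-- The parameter `rest` lets the lemma serve both X, which is followed by Y, and Y, which is
-- followed by nothing.
cell-rows : ∀ {n d} (xs : Vec (Vec Bool d) n) rest i k →
  cell (map bit (concatMap toList (toList xs)) ++ rest) (toℕ i * d + toℕ k) ≡ bit (lookup (lookup xs i) k)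
cell-rows {d = d} (x ∷ xs) rest i k
  rewrite map-++ bit (toList x) (concatMap toList (toList xs))
        | ++-assoc (map bit (toList x)) (map bit (concatMap toList (toList xs))) rest = at i
  where
  at : ∀ i → cell (map bit (toList x) ++ map bit (concatMap toList (toList xs)) ++ rest) (toℕ i * d + toℕ k)
             ≡ bit (lookup (lookup (x ∷ xs) i) k)
  at zero    = cell-row x _ k
  at (suc i) = begin
    cell (map bit (toList x) ++ bs) (d + toℕ i * d + toℕ k)
      ≡⟨ cong (cell (map bit (toList x) ++ bs)) (+-assoc d (toℕ i * d) (toℕ k)) ⟩
    cell (map bit (toList x) ++ bs) (d + (toℕ i * d + toℕ k))
      ≡⟨ cong (λ l → cell (map bit (toList x) ++ bs) (l + (toℕ i * d + toℕ k))) (length-row x) ⟨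
    cell (map bit (toList x) ++ bs) (length (map bit (toList x)) + (toℕ i * d + toℕ k))
      ≡⟨ cell-++-+ (map bit (toList x)) bs _ ⟩
    cell bs (toℕ i * d + toℕ k)
      ≡⟨ cell-rows xs rest i k ⟩
    bit (lookup (lookup xs i) k) ∎
    where
    open ≡-Reasoning
    bs = map bit (concatMap toList (toList xs)) ++ rest

length-rows : ∀ {n d} (xs : Vec (Vec Bool d) n) → length (map bit (concatMap toList (toList xs))) ≡ n * d
length-rows []       = refl
length-rows (x ∷ xs)
  rewrite map-++ bit (toList x) (concatMap toList (toList xs))
        | length-++ (map bit (toList x)) {map bit (concatMap toList (toList xs))}
  = cong₂ _+_ (length-row x) (length-rows xs)

module _ {n d : ℕ} (X Y : Vec (Vec Bool d) n) where

  private
    bits : List ℕ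
    bits = map bit (concatMap toList (toList X) ++ concatMap toList (toList Y))

    bits≡ : bits ≡ map bit (concatMap toList (toList X)) ++ map bit (concatMap toList (toList Y))
    bits≡ = map-++ bit (concatMap toList (toList X)) _

  input : List ℕ
  input = n ∷ d ∷ bits

  open Reduction input n d

  length-input : length input ≡ L
  length-input = cong (2 +_) (trans (cong length bits≡)
    (trans (length-++ (map bit (concatMap toList (toList X)))) (cong₂ _+_ (length-rows X) (length-rows Y))))

  private
    cell-input : ∀ r k → cell input (r * d + suc (suc k)) ≡ cell bits (r * d + k)
    cell-input r k = cong (cell input) (trans (+-suc (r * d) (suc k)) (cong suc (+-suc (r * d) k)))

  inc-X : ∀ i k → inc (toℕ i) (2 + toℕ k) ≡ bit (lookup (lookup X i) k)
  inc-X i k = trans (cell-input (toℕ i) (toℕ k))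
    (trans (cong (λ l → cell l (toℕ i * d + toℕ k)) bits≡) (cell-rows X _ i k))

  inc-Y : ∀ j k → inc (n + toℕ j) (2 + toℕ k) ≡ bit (lookup (lookup Y j) k)
  inc-Y j k = begin
    inc (n + toℕ j) (2 + toℕ k)              ≡⟨ cell-input (n + toℕ j) (toℕ k) ⟩
    cell bits ((n + toℕ j) * d + toℕ k)      ≡⟨ cong₂ cell (trans bits≡ (cong (rowsX ++_) (sym (++-identityʳ _)))) shift ⟩
    cell (rowsX ++ rowsY ++ []) (length rowsX + (toℕ j * d + toℕ k)) ≡⟨ cell-++-+ rowsX (rowsY ++ []) _ ⟩
    cell (rowsY ++ []) (toℕ j * d + toℕ k)   ≡⟨ cell-rows Y [] j k ⟩
    bit (lookup (lookup Y j) k)              ∎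
    where
    open ≡-Reasoning
    rowsX rowsY : List ℕ
    rowsX = map bit (concatMap toList (toList X))
    rowsY = map bit (concatMap toList (toList Y))
    shift : (n + toℕ j) * d + toℕ k ≡ length rowsX + (toℕ j * d + toℕ k)
    shift = trans (cong (_+ toℕ k) (*-distribʳ-+ d n (toℕ j)))
      (trans (+-assoc (n * d) (toℕ j * d) (toℕ k)) (cong (_+ (toℕ j * d + toℕ k)) (sym (length-rows X))))

  private
    row : ∀ r → r < n + n → Fin N
    row r r<2n = fromℕ< (subst (D + r <_) (+-comm D (n + n)) (+-monoʳ-< D r<2n))

    toℕ-row : ∀ r r<2n → toℕ (row r r<2n) ≡ D + r
    toℕ-row r r<2n = Fin.toℕ-fromℕ< _

    row-≥ : ∀ r r<2n → D ≤ toℕ (row r r<2n)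
    row-≥ r r<2n = ≤-trans (m≤m+n D r) (≤-reflexive (sym (toℕ-row r r<2n)))

    row-index : ∀ r r<2n → toℕ (row r r<2n) ∸ D ≡ r
    row-index r r<2n = trans (cong (_∸ D) (toℕ-row r r<2n)) (m+n∸m≡n D r)

    i<2n : ∀ (i : Fin n) → toℕ i < n + n
    i<2n i = <-≤-trans (Fin.toℕ<n i) (m≤m+n n n)

    n+j<2n : ∀ (j : Fin n) → n + toℕ j < n + n
    n+j<2n j = +-monoʳ-< n (Fin.toℕ<n j)

  data Column : Fin N → Set where
    is-c₀ : Column c₀
    is-c₁ : Column c₁
    is-bit : ∀ k → Column (col (2 + toℕ k) (s≤s (s≤s (Fin.toℕ<n k))))

  column-view : ∀ {c} → T (column c) → Column c
  column-view {c} Cc = view (toℕ c) refl (column⁻ {c} Cc)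
    where
    view : ∀ k → toℕ c ≡ k → k < D → Column c
    view 0 eq _ = subst Column (Fin.toℕ-injective (trans (toℕ-col 0 (s≤s z≤n)) (sym eq))) is-c₀
    view 1 eq _ = subst Column (Fin.toℕ-injective (trans (toℕ-col 1 (s≤s (s≤s z≤n))) (sym eq))) is-c₁
    view (suc (suc k)) eq (s≤s (s≤s k<d)) =
      let k′ = fromℕ< k<d in
      subst Column (Fin.toℕ-injective (trans (toℕ-col (2 + toℕ k′) (s≤s (s≤s (Fin.toℕ<n k′))))
                                             (trans (cong (2 +_) (Fin.toℕ-fromℕ< k<d)) (sym eq))))
        (is-bit k′)

  adj-bit : ∀ {v r} → D ≤ toℕ v → toℕ v ∸ D ≡ r → ∀ k {b} → inc r (2 + toℕ k) ≡ bit b →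
            adj G v (col (2 + toℕ k) (s≤s (s≤s (Fin.toℕ<n k)))) ≡ b
  adj-bit {v} D≤v refl k {b} eq =
    trans (incident {v} D≤v (s≤s (s≤s (Fin.toℕ<n k)))) (trans (cong nonzero eq) (nonzero-bit b))

  module _ {i j : Fin n} (orth : Orthogonal (lookup X i) (lookup Y j)) where

    private
      x y : Fin N
      x = row (toℕ i) (i<2n i)
      y = row (n + toℕ j) (n+j<2n j)

      D≤x : D ≤ toℕ x
      D≤x = row-≥ (toℕ i) (i<2n i)

      D≤y : D ≤ toℕ y
      D≤y = row-≥ (n + toℕ j) (n+j<2n j)

      x∸D : toℕ x ∸ D ≡ toℕ i
      x∸D = row-index (toℕ i) (i<2n i)

      y∸D : toℕ y ∸ D ≡ n + toℕ j
      y∸D = row-index (n + toℕ j) (n+j<2n j)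

      x-c₀ : adj G x c₀ ≡ true
      x-c₀ = trans (row-c₀ {x} D≤x) (trans (cong (_<ᵇ n) x∸D) (<ᵇ-true (Fin.toℕ<n i)))

      x-c₁ : adj G x c₁ ≡ false
      x-c₁ = trans (row-c₁ {x} D≤x) (cong not (trans (cong (_<ᵇ n) x∸D) (<ᵇ-true (Fin.toℕ<n i))))

      y-c₀ : adj G y c₀ ≡ false
      y-c₀ = trans (row-c₀ {y} D≤y) (trans (cong (_<ᵇ n) y∸D) (<ᵇ-false (m≤m+n n (toℕ j))))

      y-c₁ : adj G y c₁ ≡ true
      y-c₁ = trans (row-c₁ {y} D≤y) (cong not (trans (cong (_<ᵇ n) y∸D) (<ᵇ-false (m≤m+n n (toℕ j)))))

      far : ∀ c → Adj G x c → ¬ Adj G y c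
      far c xc yc with column-view {c} (split-edge G-split {x} {c} xc (row⁺ {x} D≤x))
      ... | is-c₀ = subst T y-c₀ yc
      ... | is-c₁ = subst T x-c₁ xc
      ... | is-bit k = orth k (subst T (adj-bit {x} D≤x x∸D k (inc-X i k)) xc)
                              (subst T (adj-bit {y} D≤y y∸D k (inc-Y j k)) yc)

    orthogonal⇒partition : Σ (Fin N → Fin 4) (PathPartition G)
    orthogonal⇒partition = four-path G-split {x} {y} {c₀} {c₁} (row⁺ {x} D≤x) (row⁺ {y} D≤y) column-c₀ column-c₁
                             (subst T (sym x-c₀) _) (subst T (sym y-c₁) _) far row-cover

  private
    row<2n : ∀ {w} → D ≤ toℕ w → toℕ w ∸ D < n + n
    row<2n {w} D≤w = +-cancelʳ-< D _ (n + n) (subst (_< N) (sym (m∸n+n≡m D≤w)) (Fin.toℕ<n w))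

  module _ {u v : Fin N} (D≤u : D ≤ toℕ u) (D≤v : D ≤ toℕ v) (far : ∀ c → Adj G u c → ¬ Adj G v c)
           (r<n : toℕ u ∸ D < n) (n≤r : n ≤ toℕ v ∸ D) where

    private
      s<n : toℕ v ∸ D ∸ n < n
      s<n = +-cancelˡ-< n _ n (subst (_< n + n) (sym (m+[n∸m]≡n n≤r)) (row<2n {v} D≤v))

      i j : Fin n
      i = fromℕ< r<n
      j = fromℕ< s<n

      u∸D : toℕ u ∸ D ≡ toℕ i
      u∸D = sym (Fin.toℕ-fromℕ< r<n)

      v∸D : toℕ v ∸ D ≡ n + toℕ j
      v∸D = trans (sym (m+[n∸m]≡n n≤r)) (cong (n +_) (sym (Fin.toℕ-fromℕ< s<n)))

    far⇒orthogonal : ∃[ i ] ∃[ j ] Orthogonal (lookup X i) (lookup Y j)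
    far⇒orthogonal = i , j , λ k xk yk → far (col (2 + toℕ k) (s≤s (s≤s (Fin.toℕ<n k))))
      (subst T (sym (adj-bit {u} D≤u u∸D k (inc-X i k))) xk)
      (subst T (sym (adj-bit {v} D≤v v∸D k (inc-Y j k))) yk)

  -- Two rows from the same set would share `c₀` or `c₁`. The pair thus has one row from each set,
  -- in either order.
  far-pair⇒orthogonal : ∀ {u v} → D ≤ toℕ u → D ≤ toℕ v → (∀ c → Adj G u c → ¬ Adj G v c) →
                        ∃[ i ] ∃[ j ] Orthogonal (lookup X i) (lookup Y j)
  far-pair⇒orthogonal {u} {v} D≤u D≤v far
    with <-≤-connex (toℕ u ∸ D) n | <-≤-connex (toℕ v ∸ D) n
  ... | inj₁ r<n | inj₂ n≤s = far⇒orthogonal {u} {v} D≤u D≤v far r<n n≤s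
  ... | inj₂ n≤r | inj₁ s<n = far⇒orthogonal {v} {u} D≤v D≤u (λ c vc uc → far c uc vc) s<n n≤r
  ... | inj₁ r<n | inj₁ s<n = contradiction (subst T (sym (trans (row-c₀ {v} D≤v) (<ᵇ-true s<n))) _)
                                (far c₀ (subst T (sym (trans (row-c₀ {u} D≤u) (<ᵇ-true r<n))) _))
  ... | inj₂ n≤r | inj₂ n≤s = contradiction (subst T (sym (trans (row-c₁ {v} D≤v) (cong not (<ᵇ-false n≤s)))) _)
                                (far c₁ (subst T (sym (trans (row-c₁ {u} D≤u) (cong not (<ᵇ-false n≤r)))) _))

  module _ (1≤n : 1 ≤ n) where

    private
      -- Two vectors, `c₀` and `c₁` already make four, so `N ∸ 4` is a true subtraction.
      4≤N : 4 ≤ N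
      4≤N = +-mono-≤ {2} (+-mono-≤ 1≤n 1≤n) (m≤m+n 2 d)

    orthogonal⇒contracts : ∃[ i ] ∃[ j ] (⟨ lookup X i ∙ lookup Y j ⟩ ≡ 0) → ContractsToPath G (N ∸ 4)
    orthogonal⇒contracts (i , j , eq) =
      N ∸ 4 , ≤-refl , partition-contracts (N ∸ 4) (sym (m∸n+n≡m 4≤N)) (s≤s z≤n)
        (proj₂ (orthogonal⇒partition {i} {j} (orthogonal⁺ (lookup X i) (lookup Y j) eq)))

    -- Each contraction removes one vertex, so a budget of N - 4 leaves a path on at least four.
    contracts⇒orthogonal : ContractsToPath G (N ∸ 4) → ∃[ i ] ∃[ j ] (⟨ lookup X i ∙ lookup Y j ⟩ ≡ 0)
    contracts⇒orthogonal (k , k≤ , m , H , r , path) =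
      let N≡k+m , f , onto , local = path-map r path
      in long (+-cancelˡ-≤ k 4 m (≤-trans (≤-trans (+-monoˡ-≤ 4 k≤) (≤-reflexive (m∸n+n≡m 4≤N)))
                                          (≤-reflexive N≡k+m)))
              f onto (λ {a} {b} → local {a} {b})
      where
      long : ∀ {m} → 4 ≤ m → (f : Fin N → Fin m) → (∀ j → ∃[ v ] f v ≡ j) →
             (∀ {u v} → Adj G u v → f u ≡ f v ⊎ PathAdj (f u) (f v)) →
             ∃[ i ] ∃[ j ] (⟨ lookup X i ∙ lookup Y j ⟩ ≡ 0)
      long {suc (suc (suc (suc m)))} _ f onto local =
        let u , v , ¬Cu , ¬Cv , far = long-path⇒far-pair G-split row-dominated f onto
                                        (λ {a} {b} → local {a} {b})
            i , j , orth = far-pair⇒orthogonal {u} {v} (row⁻ {u} ¬Cu) (row⁻ {v} ¬Cv) far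
        in i , j , orthogonal⁻ (lookup X i) (lookup Y j) orth
      long {1} (s≤s ())
      long {2} (s≤s (s≤s ()))
      long {3} (s≤s (s≤s (s≤s ())))

-- Treewidth, running time and word size

¬¬-treewidth : ∀ {n} {G : Graph n} (D : TreeDecomposition G) →
               ¬ ¬ (∃[ w ] (IsTreewidth G w × w ≤ TreeDecomposition.width D))
¬¬-treewidth {G = G} D none =
  ¬¬-least {P = λ w → Σ (TreeDecomposition G) λ D → TreeDecomposition.width D ≡ w} (D , refl)
    λ (w , wD , least) → none (w , (wD , λ D′ → least _ (D′ , refl)) , least _ (D , refl))

module Bounds (as : List ℕ) (n d : ℕ) where

  open Reduction as n d

  Z : ℕ
  Z = D * N

  1≤N : 1 ≤ N
  1≤N = ≤-trans (s≤s z≤n) D≤N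

  N≤Z : N ≤ Z
  N≤Z = m≤m+n N _

  -- The D columns have N candidates each and the other vertices D, about 2 D N in total; the ticks
  -- of the vertices themselves account for the rest.
  K≤3Z : K ≤ 3 * Z
  K≤3Z = begin
    K                         ≤⟨ sum-applyUpTo-≤-+ (suc D) N bound≤ ⟩
    N * suc D + sum (applyUpTo (λ v → if v <ᵇ D then N else 0) N)
                              ≤⟨ +-monoʳ-≤ (N * suc D) (sum-initial-≤ D N N) ⟩
    N * suc D + D * N         ≡⟨ regroup D N ⟩
    N + 2 * Z                 ≤⟨ +-monoˡ-≤ (2 * Z) N≤Z ⟩
    3 * Z                     ∎
    where
    open ≤-Reasoning
    regroup : ∀ D N → N * suc D + D * N ≡ N + 2 * (D * N)
    regroup = solve-∀
    bound≤ : ∀ v → suc (bound v) ≤ suc D + (if v <ᵇ D then N else 0)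
    bound≤ v with v <ᵇ D
    ... | true  = s≤s (m≤n+m N D)
    ... | false = s≤s (m≤m+n D 0)

  F≤ : F ≤ 7 * Z + 3
  F≤ = begin
    K + (K + (3 + N))              ≤⟨ +-mono-≤ K≤3Z (+-mono-≤ K≤3Z (+-monoʳ-≤ 3 N≤Z)) ⟩
    3 * Z + (3 * Z + (3 + Z))      ≡⟨ regroup Z ⟩
    7 * Z + 3                      ∎
    where
    open ≤-Reasoning
    regroup : ∀ Z → 3 * Z + (3 * Z + (3 + Z)) ≡ 7 * Z + 3
    regroup = solve-∀

  L≤Z : L ≤ Z
  L≤Z = begin
    2 + (n * d + n * d)                         ≤⟨ m≤m+n _ (2 + 4 * n + d * d + 4 * d) ⟩
    2 + (n * d + n * d) + (2 + 4 * n + d * d + 4 * d) ≡⟨ expand n d ⟩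
    Z                                           ∎
    where
    open ≤-Reasoning
    expand : ∀ n d → 2 + (n * d + n * d) + (2 + 4 * n + d * d + 4 * d) ≡ (2 + d) * (n + n + (2 + d))
    expand = solve-∀

  time : ℕ
  time = 4 + (17 + (5 + 23 * K + (5 + 23 * K + (13 + 7 * (L + F)))))

  time≤ : time ≤ 259 * Z
  time≤ = transform-steps K≤3Z L≤Z F≤ (≤-trans 1≤N N≤Z)

  -- The word size W must accommodate the reduction as well as the simulated run, whose
  -- words are those for an instance of size F = O(s²).
  module Word (w : ℕ) {s} (n≤s : n ≤ s) (d≤s : d ≤ s) where

    -- All quantities that occur are at most B ^ 3. The simulated words are thus at most (B ^ 3) ^
    -- w, whence the exponent 3 w; the added 100 gives B ≤ W + s and 3 ≤ W.
    z B W : ℕ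
    z = suc s
    B = w + 100 + s
    W = 3 * w + 100

    Z≤ : Z ≤ 6 * (z * z)
    Z≤ = begin
      (2 + d) * (n + n + (2 + d))     ≤⟨ *-mono-≤ {2 + d} {2 + s} (+-monoʳ-≤ 2 d≤s)
                                           (+-mono-≤ (+-mono-≤ n≤s n≤s) (+-monoʳ-≤ 2 d≤s)) ⟩
      (2 + s) * (s + s + (2 + s))     ≤⟨ m≤m+n _ _ ⟩
      (2 + s) * (s + s + (2 + s)) + (2 + 4 * s + 3 * (s * s)) ≡⟨ expand s ⟩
      6 * (z * z)                     ∎
      where
      open ≤-Reasoning
      expand : ∀ s → (2 + s) * (s + s + (2 + s)) + (2 + 4 * s + 3 * (s * s)) ≡ 6 * (suc s * suc s)
      expand = solve-∀

    1≤z² : 1 ≤ z * z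
    1≤z² = s≤s z≤n

    polynomial≤B³ : (w + 100) * (z * z) ≤ B ^ 3
    polynomial≤B³ = begin
      (w + 100) * (z * z)   ≤⟨ *-mono-≤ (m≤m+n (w + 100) s) (*-mono-≤ z≤B z≤B) ⟩
      B * (B * B)           ≡⟨ cong (λ b → B * (B * b)) (*-identityʳ B) ⟨
      B ^ 3                 ∎
      where
      open ≤-Reasoning
      z≤B : z ≤ B
      z≤B = +-monoˡ-≤ s (≤-trans (m≤m+n 1 99) (m≤n+m 100 w))

    total≤ : w + (L + (L + F)) ≤ (w + 100) * (z * z)
    total≤ = word-estimate L≤Z F≤ Z≤ 1≤z²

    B≤W+s : B ≤ W + s
    B≤W+s = +-monoˡ-≤ s (+-monoˡ-≤ 100 (m≤m+n w _))

    W+s≢0 : NonZero (W + s)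
    W+s≢0 = >-nonZero (≤-trans (s≤s z≤n) (≤-trans (m≤n+m 100 (3 * w)) (m≤m+n W s)))

    B³≤ : B ^ 3 ≤ (W + s) ^ W
    B³≤ = ^-mono-≤ {B} {W + s} {3} {W} {{W+s≢0}} B≤W+s (≤-trans (m≤m+n 3 97) (m≤n+m 100 (3 * w)))

    cap : L + (L + F) ≤ (W + s) ^ W
    cap = ≤-trans (m+n≤o⇒n≤o w total≤) (≤-trans polynomial≤B³ B³≤)

    2N≤ : N + N ≤ (W + s) ^ W
    2N≤ = begin
      N + N                  ≤⟨ +-monoʳ-≤ N (m≤m+n N (d * N)) ⟩
      Z                      ≤⟨ Z≤ ⟩
      6 * (z * z)            ≤⟨ *-monoˡ-≤ (z * z) (≤-trans (m≤m+n 6 94) (m≤n+m 100 w)) ⟩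
      (w + 100) * (z * z)    ≤⟨ polynomial≤B³ ⟩
      B ^ 3                  ≤⟨ B³≤ ⟩
      (W + s) ^ W            ∎
      where open ≤-Reasoning

    simulation≤ : ∀ {e} → e ≤ F → (w + e) ^ w ≤ (W + s) ^ W
    simulation≤ {e} e≤F = begin
      (w + e) ^ w       ≤⟨ ^-monoˡ-≤ w (≤-trans (+-monoʳ-≤ w (≤-trans e≤F (≤-trans (m≤n+m F L) (m≤n+m (L + F) L))))
                             (≤-trans total≤ polynomial≤B³)) ⟩
      (B ^ 3) ^ w       ≡⟨ ^-*-assoc B 3 w ⟩
      B ^ (3 * w)       ≤⟨ ^-monoˡ-≤ (3 * w) B≤W+s ⟩
      (W + s) ^ (3 * w) ≤⟨ ^-monoʳ-≤ (W + s) {{W+s≢0}} {3 * w} {W} (m≤m+n (3 * w) 100) ⟩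
      (W + s) ^ W       ∎
      where open ≤-Reasoning

-- The algorithm for Orthogonal Vectors

Decides : (p q : ℕ) (f : ℕ → ℕ) (C : ℕ) (P : Program) (w : ℕ) → ChordalInstance → Set
Decides p q f C P w I = let as = encode PathContractionOnChordal I; open ChordalInstance I in
  ∃[ t ] ∃[ τ ] ((((w + size as) ^ w) ⊢ P , initial as ⇓[ t ] τ)
                 × (Accepting τ ⇔ Yes PathContractionOnChordal I)
                 × (∀ tw → IsTreewidth G tw → t ^ q * n ^ p ≤ (C * n ^ 2 * 2 ^ f tw) ^ q))

module Solve
  (p q c : ℕ) .{{p≢0 : NonZero p}} .{{q≢0 : NonZero q}} (f : ℕ → ℕ) (C g e R : ℕ) (1≤R : 1 ≤ R)
  (hR : ∀ n tw → 1 ≤ n → tw ≤ 2 + c * ⌈log₂ n ⌉ → 2 ^ (2 * q * f tw) ≤ R * n)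
  (hg : ∀ n d → 1 ≤ n → d ≤ c * ⌈log₂ n ⌉ → n + n + (2 + d) ≤ g * n)
  (he : ∀ {as} n d → 1 ≤ n → d ≤ c * ⌈log₂ n ⌉ → Bounds.time as n d ^ 2 ≤ e * n ^ 3)
  (P : Program) (w : ℕ)
  (run : ∀ I → Decides p q f C P w I)
  where

  S H : ℕ
  S = C * g ^ 2 * R
  H = e + S

  module _ (n d : ℕ) (d≤ : d ≤ c * ⌈log₂ n ⌉) (X Y : Vec (Vec Bool d) n) where

    as : List ℕ
    as = input X Y

    open Reduction as n d
    open Bounds as n d

    s M : ℕ
    s = size as

    open Word w {s} (cell≤size as 0) (cell≤size as 1)

    M = (W + s) ^ W

    100≤W : 100 ≤ W
    100≤W = m≤n+m 100 (3 * w)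

    s≤M : s ≤ M
    s≤M = ≤-trans (m≤n+m s W) (m≤m^n (W + s) W {{>-nonZero (≤-trans (s≤s z≤n) 100≤W)}})

    1≤M : 1 ≤ M
    1≤M = m^n>0 (W + s) {{W+s≢0}} W

    as≤M : ∀ j → cell as j ≤ M
    as≤M j = ≤-trans (cell≤size as j) s≤M

    initial≈ : initial as ≈ state (zeros ▸ cell as)
    initial≈ = (λ j → sym (cell-replicate-0 17 j)) , λ _ → refl

    target : ChordalInstance
    target = record { n = N ; G = G ; connected = G-connected ; chordal = G-chordal ; k = N ∸ 4 }

    encoding : List ℕ
    encoding = encode PathContractionOnChordal target

    size-encoding : size encoding ≤ F
    size-encoding = subst (λ xs → size xs ≤ F) output≡encoding
      (⊔-lub (m+n≤o⇒n≤o (proj₁ emitted) (Fits.weight emitted-fits)) (max≤ (Fits.values emitted-fits)))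

    steps : ℕ
    steps = proj₁ (run target)

    simulate : Halts M P (zeros ▸ cell output) steps (λ τ → Accepting τ ⇔ ContractsToPath G (N ∸ 4))
    simulate .Halts.halt {σ} (r , m) =
      let _ , τ , runs , correct , _ = run target
          τ′ , runs′ , τ≈τ′ = run-resp initial≈σ (run-mono (simulation≤ size-encoding) runs)
          same = _≈_.reg≗ τ≈τ′ 0
      in steps , τ′ , runs′ , ≤-refl ,
         mk⇔ (λ acc → to correct (trans same acc)) (λ yes → trans (sym same) (from correct yes))
      where
      initial≈σ : initial encoding ≈ σ
      initial≈σ = (λ j → sym (trans (r j) (cell-replicate-0 17 j))) ,
                  (λ j → sym (trans (m j) (cong (λ l → cell l j) output≡encoding)))

    halts : 1 ≤ n → Halts M (reductionP P) (zeros ▸ cell as) (time + steps)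
                      (λ τ → Accepting τ ⇔ ContractsToPath G (N ∸ 4))
    halts 1≤n =
      constᶜ 1≤M ⟫ʰ loadᶜ refl (as≤M 0) ⟫ʰ loadᶜ refl (as≤M 1) ⟫ʰ
      ifnz-≢ʰ (λ n≡0 → <⇒≢ 1≤n (sym n≡0))
        (transformᶜ (length-input X Y) as≤M 2N≤ cap ⟫ʰ simulate)

    -- The assumed time bound applies only to the exact treewidth. As the goal is a decidable
    -- inequality, its double negation may be proved, and there a treewidth is available; the width
    -- of the star decomposition bounds it by D.
    steps-bound : 1 ≤ n → steps ^ (2 * q) * n ≤ (S * n ^ 2) ^ (2 * q)
    steps-bound 1≤n = decidable-stable (_ ≤? _) λ ¬bound →
      ¬¬-treewidth (split-decomposition G-split) λ (tw , isTw , tw≤width) →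
        ¬bound (simulation-time {y = 2 ^ f tw} {C = C} {g} p q 1≤n
          (≤-trans (m≤m+n n n) (m≤m+n (n + n) D)) (hg n d 1≤n d≤) 1≤R
          (≤-trans (≤-reflexive (trans (^-*-assoc 2 (f tw) (2 * q)) (cong (2 ^_) (*-comm (f tw) (2 * q)))))
            (hR n tw 1≤n (≤-trans tw≤width (≤-trans (split-width G-split)
              (≤-trans (∣tabulate-<∣ N D) (+-monoʳ-≤ 2 d≤))))))
          (proj₂ (proj₂ (proj₂ (proj₂ (run target)))) tw isTw))

    time-bound : 1 ≤ n → ∀ {t} → t ≤ time + steps → t ^ (2 * q) * n ^ 1 ≤ (2 * H * n ^ 2) ^ (2 * q)
    time-bound 1≤n {t} t≤ = begin
      t ^ (2 * q) * n ^ 1                 ≡⟨ cong (t ^ (2 * q) *_) (^-identityʳ n) ⟩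
      t ^ (2 * q) * n                     ≤⟨ *-monoˡ-≤ n (^-monoˡ-≤ (2 * q) t≤) ⟩
      (time + steps) ^ (2 * q) * n        ≤⟨ sum-time {time} {steps} {H * n ^ 2} (2 * q)
        (≤-trans (transform-time {time} {n} {e} q 1≤n (he {as} n d 1≤n d≤))
                 (^-monoˡ-≤ (2 * q) (*-monoˡ-≤ (n ^ 2) (m≤m+n e S))))
        (≤-trans (steps-bound 1≤n) (^-monoˡ-≤ (2 * q) (*-monoˡ-≤ (n ^ 2) (m≤n+m S e)))) ⟩
      (2 * (H * n ^ 2)) ^ (2 * q)         ≡⟨ cong (_^ (2 * q)) (*-assoc 2 H (n ^ 2)) ⟨
      (2 * H * n ^ 2) ^ (2 * q)           ∎
      where open ≤-Reasoning

    Answer : Set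
    Answer = ∃[ t ] ∃[ τ ] ((M ⊢ reductionP P , initial as ⇓[ t ] τ)
               × (Accepting τ ⇔ (∃[ i ] ∃[ j ] (⟨ lookup X i ∙ lookup Y j ⟩ ≡ 0)))
               × t ^ (2 * q) * n ^ 1 ≤ (2 * H * n ^ 2) ^ (2 * q))

    answer-nonempty : 1 ≤ n → Answer
    answer-nonempty 1≤n =
      let t , τ , runs , t≤ , correct = Halts.halt (halts 1≤n) initial≈
      in t , τ , runs , mk⇔ (contracts⇒orthogonal X Y 1≤n ∘ to correct)
                            (from correct ∘ orthogonal⇒contracts X Y 1≤n) ,
         time-bound 1≤n t≤

    -- For n = 0 the graph is an edge, which is a path although no pair exists.
    answer-empty : n ≡ 0 → Answer
    answer-empty refl =
      let t , τ , runs , _ , (r , _) = Computes.run rejects initial≈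
      in t , τ , runs , mk⇔ (λ acc → contradiction (trans (sym (r 0)) acc) λ ()) (λ { (() , _) }) ,
         ≤-trans (≤-reflexive (*-zeroʳ (t ^ (2 * q)))) z≤n
      where
      rejects : Computes M (reductionP P) (zeros ▸ cell as) 5
                  (0 ∷ 1 ∷ 0 ∷ d ∷ 0 ∷ 0 ∷ 0 ∷ 0 ∷ 0 ∷ 0 ∷ 0 ∷ 0 ∷ 0 ∷ 0 ∷ 0 ∷ 0 ∷ 0 ∷ [] ▸ cell as)
      rejects = constᶜ 1≤M ⟫ loadᶜ refl (as≤M 0) ⟫ loadᶜ refl (as≤M 1) ⟫ ifnz-≡ᶜ refl skipᶜ

    answer : Answer
    answer with n ≟ 0
    ... | yes n≡0 = answer-empty n≡0
    ... | no n≢0  = answer-nonempty (n≢0⇒n>0 n≢0)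

  ov-decidable : OVDecidable c 1 (2 * q)
  ov-decidable = 2 * H , reductionP P , 3 * w + 100 , λ I → let open OVInstance I in answer n d d≤ X Y

theorem4 : OrthogonalVectorsConjecture → ∀ (p q : ℕ) .{{_ : NonZero p}} .{{_ : NonZero q}} → ¬ PathContractionDecidable p q
theorem4 ovc p q (f , sublinear , C , P , w , run) = ovc 1 (2 * q) {{_}} {{m*n≢0 2 q}} λ c →
  -- With D ^ 2 ≤ h n, N ≤ g n and at most 259 D N steps for the transformation, the square of its
  -- time is at most 259 ^ 2 h g ^ 2 n ^ 3.
  let h = (2 + c) * (2 + c) * 8
      g = 4 + 2 * c
      R , 1≤R , hR = sublinear-bound sublinear c (2 * q)
  in Solve.ov-decidable p q c f C g (259 * 259 * h * (g * g)) R 1≤R hR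
       (λ _ _ → vertices-bound {c})
       (λ {as} n d 1≤n d≤ → square-bound 259 {2 + d} {n + n + (2 + d)} {n} {h} {g} (columns-bound {c} 1≤n d≤)
          (vertices-bound {c} 1≤n d≤) (Bounds.time≤ as n d))
       P w run
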